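{- Let $\mathbf{C}$ be an adhesive category (i.e. $\mathcal{M}$ is the class of all monomorphisms) satisfying the standing assumptions of the SqPO setting described in the context. Let $R_j=(r_j,\mathsf{c}_{I_j})$, $j=1,2,3$, be linear rules with application conditions. Define $$M_A:=\{(\mu_{21},\mu_{3(21)})\mid \mu_{21}\in M^{sq}_{R_2}(R_1),\ \mu_{3(21)}\in M^{sq}_{R_3}(R_{21})\},\quad R_{21}:=R_2\,{}^{\mu_{21}}\!\!\circ_{sq} R_1,$$ $$M_B:=\{(\mu_{32},\mu_{(32)1})\mid \mu_{32}\in M^{sq}_{R_3}(R_2),\ \mu_{(32)1}\in M^{sq}_{R_{32}}(R_1)\},\quad R_{32}:=R_3\,{}^{\mu_{32}}\!\!\circ_{sq} R_2.$$ Then there is a bijection between $M_A$ and $M_B$ such that whenever $(\mu_{21},\mu_{3(21)})$ corresponds to $(\mu_{32},\mu_{(32)1})$, the underlying linear rules satisfy $r_3\,{}^{\mu_{3(21)}}\!\!\circ_{sq}(r_2\,{}^{\mu_{21}}\!\!\circ_{sq} r_1)\cong(r_3\,{}^{\mu_{32}}\!\!\circ_{sq} r_2)\,{}^{\mu_{(32)1}}\!\!\circ_{sq} r_1$, and the corresponding application conditions $\mathsf{c}_{I_{3(21)}}$ and $\mathsf{c}_{I_{(32)1}}$ (identified along this isomorphism) are equivalent, $\mathsf{c}_{I_{3(21)}}\equiv\mathsf{c}_{I_{(32)1}}$.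
   Context: Base setting. $\mathcal{M}$ is a class of monomorphisms of $\mathbf{C}$ with $(\mathbf{C},\mathcal{M})$ $\mathcal{M}$-adhesive: $\mathcal{M}$ contains isos, is closed under composition and decomposition ($g\circ f,g\in\mathcal{M}\Rightarrow f\in\mathcal{M}$); pushouts and pullbacks along $\mathcal{M}$-morphisms exist; $\mathcal{M}$ is stable under pushout and pullback; pushouts along $\mathcal{M}$-morphisms are $\mathcal{M}$-van Kampen squares. Further: epi-$\mathcal{M}$-factorizations exist; $\mathbf{C}$ is balanced; $\mathbf{C}$ has a strict $\mathcal{M}$-initial object $\varnothing$; $\mathbf{C}$ has $\mathcal{M}$-effective unions (if $B\xleftarrow{b'}A\xrightarrow{c'}C$ are $\mathcal{M}$-morphisms with pushout $D$, and $\mathcal{M}$-morphisms $b:B\to E$, $c:C\to E$ with $b b'=c c'$ form a pullback, then the induced $D\to E$ is in $\mathcal{M}$). SqPO extras: a pair $(b:A\to D,d:D\to C)$ is a final pullback complement (FPC) of composable $A\xrightarrow{a}B\xrightarrow{c}C$ if $c\circ a=d\circ b$ is a pullback and for every pullback square $P\xrightarrow{x}B$, $P\xrightarrow{y}Q$, $c\circ x=z\circ y$ with $z:Q\to C$, and every $w:P\to A$ with $a\circ w=x$, there is a unique $w^*:Q\to D$ with $d\circ w^*=z$ and $w^*\circ y=w$. Assume FPCs of all composable pairs of $\mathcal{M}$-morphisms exist and consist of $\mathcal{M}$-morphisms. Conditions, satisfaction ($\models$ by $\mathcal{M}$-morphisms), equivalence $\equiv$, $\mathsf{false},\bigvee$: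 as usual — conditions over $P$: $\mathsf{true}$, $\exists(a,\mathsf{c}_Q)$ ($a:P\to Q$ in $\mathcal{M}$), $\neg$, $\bigwedge$; $p\models\exists(a,\mathsf{c}_Q)$ iff there is $q\in\mathcal{M}$ with $q\circ a=p$, $q\models\mathsf{c}_Q$; $\mathsf{c}\equiv\mathsf{c}'$ iff satisfied by the same $\mathcal{M}$-morphisms. $\mathsf{Shift}(p,\cdot)$ along an $\mathcal{M}$-morphism $p:P\to Q$: commutes with $\mathsf{true},\neg,\bigwedge$, and $\mathsf{Shift}(p,\exists(a:P\to A,\mathsf{c}_A))=\bigvee_{(r,s)}\exists(r,\mathsf{Shift}(s,\mathsf{c}_A))$ over iso classes of pushouts $(r:Q\to E,s:A\to E)$ of spans $Q\xleftarrow{p''}X\xrightarrow{a''}A$ of $\mathcal{M}$-morphisms admitting an $\mathcal{M}$-morphism $x:P\to X$ with $p''x=p$, $a''x=a$. Linear rules $r=(O\xleftarrow{o}K\xrightarrow{i}I)$ are spans of $\mathcal{M}$-morphisms; rules with conditions $R=(r,\mathsf{c}_I)$. $\mathsf{Trans}(r,\mathsf{c}_O)$: $\mathsf{true}\mapsto\mathsf{true}$, commutes with $\neg,\bigwedge$; $\exists(a:O\to O',\mathsf{c}')\mapsto\exists(a^*,\mathsf{Trans}(r',\mathsf{c}'))$ if the pushout complement $K\to K'\xrightarrow{o'}O'$ of $K\xrightarrow{o}O\xrightarrow{a}O'$ exists, where $I\xrightarrow{a^*}I'\xleftarrow{i'}K'$ is the pushout of $I\xleftarrow{i}K\to K'$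 and $r'=(O'\xleftarrow{o'}K'\xrightarrow{i'}I')$, and $\mapsto\mathsf{false}$ otherwise. SqPO composition. For $R_j=(r_j,\mathsf{c}_{I_j})$, $r_j=(O_j\xleftarrow{o_j}K_j\xrightarrow{i_j}I_j)$, and a span $\mu_{21}=(I_2\xleftarrow{m_2}M_{21}\xrightarrow{m_1}O_1)$ of $\mathcal{M}$-morphisms, let $I_2\xrightarrow{m_2'}N_{21}\xleftarrow{m_1'}O_1$ be its pushout; let $K_2\to K_2'\to N_{21}$ be the FPC of $K_2\xrightarrow{i_2}I_2\xrightarrow{m_2'}N_{21}$; require a pushout complement $K_1\to K_1'\to N_{21}$ of $K_1\xrightarrow{o_1}O_1\xrightarrow{m_1'}N_{21}$; let $O_{21}$ be the pushout of $O_2\xleftarrow{o_2}K_2\to K_2'$, $I_{21}$ the pushout of $K_1'\leftarrow K_1\xrightarrow{i_1}I_1$ (with $p_1:I_1\to I_{21}$), $K_{21}$ the pullback of $K_2'\to N_{21}\leftarrow K_1'$, $r_2\,{}^{\mu_{21}}\!\!\circ_{sq} r_1:=(O_{21}\leftarrow K_{21}\to I_{21})$, and $\mathsf{c}_{I_{21}}:=\mathsf{Shift}(p_1,\mathsf{c}_{I_1})\wedge\mathsf{Trans}((N_{21}\leftarrow K_1'\to I_{21}),\mathsf{Shift}(m_2',\mathsf{c}_{I_2}))$. If constructible and $\mathsf{c}_{I_{21}}\not\equiv\mathsf{false}$, $\mu_{21}\in M^{sq}_{R_2}(R_1)$ and $R_2\,{}^{\mu_{21}}\!\!\circ_{sq}R_1:=(r_2\,{}^{\mu_{21}}\!\!\circ_{sq}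 r_1,\mathsf{c}_{I_{21}})$. -}

module Defs where

open import Level using (Level; _⊔_; suc; Lift; lift)
open import Data.Product using (Σ; _×_; _,_; Σ-syntax)
open import Data.Unit.Polymorphic using (⊤)
open import Data.Bool using (Bool)
import Data.Bool as B
open import Relation.Nullary using (¬_)
open import Relation.Binary.PropositionalEquality using (_≡_)

record Category (o ℓ : Level) : Set (suc (o ⊔ ℓ)) where
  infixr 9 _∘_
  field
    Obj       : Set o
    Hom       : Obj → Obj → Set ℓ
    id        : ∀ {A} → Hom A A
    _∘_       : ∀ {A B C} → Hom B C → Hom A B → Hom A C
    identityˡ : ∀ {A B} {f : Hom A B} → id ∘ f ≡ f
    identityʳ : ∀ {A B} {f : Hom A B} → f ∘ id ≡ f
    assoc     : ∀ {A B C D} {f : Hom A B} {g : Hom B C} {h : Hom C D} →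
                (h ∘ g) ∘ f ≡ h ∘ (g ∘ f)

module _ {o ℓ : Level} (𝒞 : Category o ℓ) where
  open Category 𝒞

  Mono : ∀ {A B} → Hom A B → Set (o ⊔ ℓ)
  Mono {A} f = ∀ {X} (g h : Hom X A) → f ∘ g ≡ f ∘ h → g ≡ h

  Epi : ∀ {A B} → Hom A B → Set (o ⊔ ℓ)
  Epi {B = B} f = ∀ {X} (g h : Hom B X) → g ∘ f ≡ h ∘ f → g ≡ h

  Iso : ∀ {A B} → Hom A B → Set ℓ
  Iso {A} {B} f = Σ[ g ∈ Hom B A ] (g ∘ f ≡ id × f ∘ g ≡ id)

  record IsPullback {A B C D : Obj} (f : Hom A B) (g : Hom A C) (h : Hom B D) (k : Hom C D)
         : Set (o ⊔ ℓ) where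
    field
      commute   : h ∘ f ≡ k ∘ g
      universal : ∀ {X} (x : Hom X B) (y : Hom X C) → h ∘ x ≡ k ∘ y →
                  Σ[ u ∈ Hom X A ] (f ∘ u ≡ x × g ∘ u ≡ y)
      unique    : ∀ {X} (u v : Hom X A) → f ∘ u ≡ f ∘ v → g ∘ u ≡ g ∘ v → u ≡ v

  record IsPushout {A B C D : Obj} (f : Hom A B) (g : Hom A C) (h : Hom B D) (k : Hom C D)
         : Set (o ⊔ ℓ) where
    field
      commute   : h ∘ f ≡ k ∘ g
      universal : ∀ {X} (x : Hom B X) (y : Hom C X) → x ∘ f ≡ y ∘ g →
                  Σ[ u ∈ Hom D X ] (u ∘ h ≡ x × u ∘ k ≡ y)
      unique    : ∀ {X} (u v : Hom D X) → u ∘ h ≡ v ∘ h → u ∘ k ≡ v ∘ k → u ≡ v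

  record IsFPC {A B C D : Obj} (a : Hom A B) (c : Hom B C) (b : Hom A D) (d : Hom D C)
         : Set (o ⊔ ℓ) where
    field
      pullback  : IsPullback a b c d
      universal : ∀ {P Q} (x : Hom P B) (y : Hom P Q) (z : Hom Q C) → IsPullback x y c z →
                  (w : Hom P A) → a ∘ w ≡ x →
                  Σ[ w* ∈ Hom Q D ] (d ∘ w* ≡ z × w* ∘ y ≡ b ∘ w)
      unique    : ∀ {P Q} (x : Hom P B) (y : Hom P Q) (z : Hom Q C) → IsPullback x y c z →
                  (w : Hom P A) → a ∘ w ≡ x →
                  (u v : Hom Q D) → d ∘ u ≡ z → u ∘ y ≡ b ∘ w → d ∘ v ≡ z → v ∘ y ≡ b ∘ w → u ≡ v

  IsVanKampen : ∀ {A B C D} (f : Hom A B) (g : Hom A C) (h : Hom B D) (k : Hom C D) → Set (o ⊔ ℓ)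
  IsVanKampen {A} {B} {C} {D} f g h k =
    ∀ {A' B' C' D'} (f' : Hom A' B') (g' : Hom A' C') (h' : Hom B' D') (k' : Hom C' D')
      (a : Hom A' A) (b : Hom B' B) (c : Hom C' C) (d : Hom D' D) →
      h' ∘ f' ≡ k' ∘ g' → b ∘ f' ≡ f ∘ a → c ∘ g' ≡ g ∘ a →
      d ∘ h' ≡ h ∘ b → d ∘ k' ≡ k ∘ c →
      IsPullback f' a b f → IsPullback g' a c g →
      (IsPushout f' g' h' k' → IsPullback h' b d h × IsPullback k' c d k) ×
      (IsPullback h' b d h × IsPullback k' c d k → IsPushout f' g' h' k')

  record SqPOAdhesive : Set (o ⊔ ℓ) where
    field
      pullbacks            : ∀ {B C D} (h : Hom B D) (k : Hom C D) →
                             Σ[ A ∈ Obj ] Σ[ f ∈ Hom A B ] Σ[ g ∈ Hom A C ] IsPullback f g h k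
      pushouts-along-mono  : ∀ {A B C} (f : Hom A B) (g : Hom A C) → Mono f →
                             Σ[ D ∈ Obj ] Σ[ h ∈ Hom B D ] Σ[ k ∈ Hom C D ] IsPushout f g h k
      mono-pushout-stable  : ∀ {A B C D} {f : Hom A B} {g : Hom A C} {h : Hom B D} {k : Hom C D} →
                             IsPushout f g h k → Mono f → Mono k
      mono-pullback-stable : ∀ {A B C D} {f : Hom A B} {g : Hom A C} {h : Hom B D} {k : Hom C D} →
                             IsPullback f g h k → Mono k → Mono f
      van-Kampen           : ∀ {A B C D} {f : Hom A B} {g : Hom A C} {h : Hom B D} {k : Hom C D} →
                             IsPushout f g h k → Mono f → IsVanKampen f g h k
      epi-mono-factor      : ∀ {A B} (f : Hom A B) →
                             Σ[ E ∈ Obj ] Σ[ e ∈ Hom A E ] Σ[ m ∈ Hom E B ] (Epi e × Mono m × m ∘ e ≡ f)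
      balanced             : ∀ {A B} (f : Hom A B) → Mono f → Epi f → Iso f
      initial              : Obj
      initial-arrow        : ∀ X → Hom initial X
      initial-unique       : ∀ {X} (u v : Hom initial X) → u ≡ v
      initial-mono         : ∀ {X} (u : Hom initial X) → Mono u
      initial-strict       : ∀ {X} (u : Hom X initial) → Iso u
      effective-unions     : ∀ {A B C D E} (b' : Hom A B) (c' : Hom A C) (h : Hom B D) (k : Hom C D)
                             (b : Hom B E) (c : Hom C E) (u : Hom D E) →
                             Mono b' → Mono c' → Mono b → Mono c →
                             IsPushout b' c' h k → IsPullback b' c' b c →
                             u ∘ h ≡ b → u ∘ k ≡ c → Mono u
      fpcs                 : ∀ {A B C} (a : Hom A B) (c : Hom B C) → Mono a → Mono c →
                             Σ[ D ∈ Obj ] Σ[ b ∈ Hom A D ] Σ[ d ∈ Hom D C ]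
                               (IsFPC a c b d × Mono b × Mono d)

  data Cond : Obj → Set (suc (o ⊔ ℓ)) where
    cTrue : ∀ {P} → Cond P
    cEx   : ∀ {P Q} (a : Hom P Q) → Mono a → Cond Q → Cond P
    cNot  : ∀ {P} → Cond P → Cond P
    cAnd  : ∀ {P} (I : Set (o ⊔ ℓ)) → (I → Cond P) → Cond P

  cFalse : ∀ {P} → Cond P
  cFalse = cNot cTrue

  cOr : ∀ {P} (I : Set (o ⊔ ℓ)) → (I → Cond P) → Cond P
  cOr I f = cNot (cAnd I (λ i → cNot (f i)))

  private
    pick : ∀ {P} → Cond P → Cond P → Lift (o ⊔ ℓ) Bool → Cond P
    pick c d (lift B.true)  = c
    pick c d (lift B.false) = d

  _∧c_ : ∀ {P} → Cond P → Cond P → Cond P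
  c ∧c d = cAnd (Lift (o ⊔ ℓ) Bool) (pick c d)

  Sat : ∀ {P G} → Hom P G → Cond P → Set (o ⊔ ℓ)
  Sat p cTrue = ⊤
  Sat {G = G} p (cEx {Q = Q} a _ c) = Σ[ q ∈ Hom Q G ] (Mono q × q ∘ a ≡ p × Sat q c)
  Sat p (cNot c) = ¬ Sat p c
  Sat p (cAnd I f) = ∀ i → Sat p (f i)

  _≈c_ : ∀ {P} → Cond P → Cond P → Set (o ⊔ ℓ)
  _≈c_ {P} c d = ∀ {G} (p : Hom P G) → Mono p → (Sat p c → Sat p d) × (Sat p d → Sat p c)

  -- Shift (disjunction over all representatives of the relevant pushouts)

  record ShiftIdx {P Q A : Obj} (p : Hom P Q) (a : Hom P A) : Set (o ⊔ ℓ) where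
    field
      X        : Obj
      p''      : Hom X Q
      a''      : Hom X A
      p''-mono : Mono p''
      a''-mono : Mono a''
      x        : Hom P X
      x-mono   : Mono x
      p''x     : p'' ∘ x ≡ p
      a''x     : a'' ∘ x ≡ a
      E        : Obj
      r        : Hom Q E
      s        : Hom A E
      po       : IsPushout p'' a'' r s
      r-mono   : Mono r

  Shift : ∀ {P Q} → Hom P Q → Cond P → Cond Q
  Shift p cTrue = cTrue
  Shift p (cEx a _ c) =
    cOr (ShiftIdx p a) (λ t → cEx (ShiftIdx.r t) (ShiftIdx.r-mono t) (Shift (ShiftIdx.s t) c))
  Shift p (cNot c) = cNot (Shift p c)
  Shift p (cAnd I f) = cAnd I (λ i → Shift p (f i))

  record TransIdx {O K I O' : Obj} (ko : Hom K O) (i : Hom K I) (a : Hom O O') : Set (o ⊔ ℓ) where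
    field
      K'      : Obj
      k       : Hom K K'
      o'      : Hom K' O'
      poc     : IsPushout ko k a o'
      I'      : Obj
      a*      : Hom I I'
      i'      : Hom K' I'
      po      : IsPushout i k a* i'
      a*-mono : Mono a*

  Trans : ∀ {O K I} → Hom K O → Hom K I → Cond O → Cond I
  Trans ko i cTrue = cTrue
  Trans ko i (cEx a _ c) =
    cOr (TransIdx ko i a)
        (λ t → cEx (TransIdx.a* t) (TransIdx.a*-mono t) (Trans (TransIdx.o' t) (TransIdx.i' t) c))
  Trans ko i (cNot c) = cNot (Trans ko i c)
  Trans ko i (cAnd J f) = cAnd J (λ j → Trans ko i (f j))

  record Rule : Set (o ⊔ ℓ) where
    constructor mkRule
    field
      Out Ker In : Obj
      outL    : Hom Ker Out
      inL     : Hom Ker In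
      outL-mono : Mono outL
      inL-mono  : Mono inL

  record RuleC : Set (suc (o ⊔ ℓ)) where
    constructor mkRuleC
    field
      rl   : Rule
      cond : Cond (Rule.In rl)

  OutC KerC InC : RuleC → Obj
  OutC R = Rule.Out (RuleC.rl R)
  KerC R = Rule.Ker (RuleC.rl R)
  InC  R = Rule.In  (RuleC.rl R)

  outC : (R : RuleC) → Hom (KerC R) (OutC R)
  outC R = Rule.outL (RuleC.rl R)

  inC : (R : RuleC) → Hom (KerC R) (InC R)
  inC R = Rule.inL (RuleC.rl R)

  record Span (A B : Obj) : Set (o ⊔ ℓ) where
    field
      apex    : Obj
      sl      : Hom apex A
      sr      : Hom apex B
      sl-mono : Mono sl
      sr-mono : Mono sr

  record Comp (R₂ R₁ : RuleC) (μ : Span (InC R₂) (OutC R₁)) : Set (o ⊔ ℓ) where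
    field
      N      : Obj
      m₂'    : Hom (InC R₂) N
      m₁'    : Hom (OutC R₁) N
      po-N   : IsPushout (Span.sl μ) (Span.sr μ) m₂' m₁'
      K₂'    : Obj
      k₂     : Hom (KerC R₂) K₂'
      n₂     : Hom K₂' N
      fpc-K₂ : IsFPC (inC R₂) m₂' k₂ n₂
      K₁'    : Obj
      k₁     : Hom (KerC R₁) K₁'
      n₁     : Hom K₁' N
      poc-K₁ : IsPushout (outC R₁) k₁ m₁' n₁
      O₂₁    : Obj
      j₂     : Hom (OutC R₂) O₂₁
      jK     : Hom K₂' O₂₁
      po-O   : IsPushout (outC R₂) k₂ j₂ jK
      I₂₁    : Obj
      q₁     : Hom K₁' I₂₁
      p₁     : Hom (InC R₁) I₂₁
      po-I   : IsPushout k₁ (inC R₁) q₁ p₁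
      K₂₁    : Obj
      e₂     : Hom K₂₁ K₂'
      e₁     : Hom K₂₁ K₁'
      pb-K   : IsPullback e₂ e₁ n₂ n₁
      out-mono : Mono (jK ∘ e₂)
      in-mono  : Mono (q₁ ∘ e₁)

  module _ {R₂ R₁ : RuleC} {μ : Span (InC R₂) (OutC R₁)} (C : Comp R₂ R₁ μ) where
    open Comp C

    compRule : Rule
    compRule = mkRule O₂₁ K₂₁ I₂₁ (jK ∘ e₂) (q₁ ∘ e₁) out-mono in-mono

    compCond : Cond I₂₁
    compCond = Shift p₁ (RuleC.cond R₁) ∧c Trans n₁ q₁ (Shift m₂' (RuleC.cond R₂))

    compRuleC : RuleC
    compRuleC = mkRuleC compRule compCond

    Admissible : Set (o ⊔ ℓ)
    Admissible = ¬ (compCond ≈c cFalse)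

  record MA (R₁ R₂ R₃ : RuleC) : Set (o ⊔ ℓ) where
    field
      μ₂₁   : Span (InC R₂) (OutC R₁)
      C₂₁   : Comp R₂ R₁ μ₂₁
      adm₂₁ : Admissible C₂₁
      μ₃    : Span (InC R₃) (OutC (compRuleC C₂₁))
      C₃    : Comp R₃ (compRuleC C₂₁) μ₃
      adm₃  : Admissible C₃

  record MB (R₁ R₂ R₃ : RuleC) : Set (o ⊔ ℓ) where
    field
      μ₃₂   : Span (InC R₃) (OutC R₂)
      C₃₂   : Comp R₃ R₂ μ₃₂
      adm₃₂ : Admissible C₃₂
      μ₁    : Span (InC (compRuleC C₃₂)) (OutC R₁)
      C₁    : Comp (compRuleC C₃₂) R₁ μ₁
      adm₁  : Admissible C₁

  resultA : ∀ {R₁ R₂ R₃} → MA R₁ R₂ R₃ → RuleC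
  resultA a = compRuleC (MA.C₃ a)

  resultB : ∀ {R₁ R₂ R₃} → MB R₁ R₂ R₃ → RuleC
  resultB b = compRuleC (MB.C₁ b)

  record SpanIsoOver {A B A' B'} (tA : Hom A A') (tB : Hom B B') (μ : Span A B) (μ' : Span A' B')
         : Set (o ⊔ ℓ) where
    field
      φ     : Hom (Span.apex μ) (Span.apex μ')
      φ-iso : Iso φ
      φ-l   : Span.sl μ' ∘ φ ≡ tA ∘ Span.sl μ
      φ-r   : Span.sr μ' ∘ φ ≡ tB ∘ Span.sr μ

  -- Identity of pairs of matches up to isomorphism (the second span is
  -- compared along the canonical isomorphism of the intermediate composites).
  record SimA {R₁ R₂ R₃} (a a' : MA R₁ R₂ R₃) : Set (o ⊔ ℓ) where
    private
      module X = MA a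
      module Y = MA a'
      module CX = Comp X.C₂₁
      module CY = Comp Y.C₂₁
    field
      iso₂₁ : SpanIsoOver id id X.μ₂₁ Y.μ₂₁
      ν     : Hom CX.N CY.N
      ν-iso : Iso ν
      ν-2   : ν ∘ CX.m₂' ≡ CY.m₂'
      ν-1   : ν ∘ CX.m₁' ≡ CY.m₁'
      κ     : Hom CX.K₂' CY.K₂'
      κ-iso : Iso κ
      κ-k   : κ ∘ CX.k₂ ≡ CY.k₂
      κ-n   : CY.n₂ ∘ κ ≡ ν ∘ CX.n₂
      θ     : Hom CX.O₂₁ CY.O₂₁
      θ-iso : Iso θ
      θ-j   : θ ∘ CX.j₂ ≡ CY.j₂
      θ-K   : θ ∘ CX.jK ≡ CY.jK ∘ κ
      iso₃  : SpanIsoOver id θ X.μ₃ Y.μ₃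

  record SimB {R₁ R₂ R₃} (b b' : MB R₁ R₂ R₃) : Set (o ⊔ ℓ) where
    private
      module X = MB b
      module Y = MB b'
      module CX = Comp X.C₃₂
      module CY = Comp Y.C₃₂
    field
      iso₃₂ : SpanIsoOver id id X.μ₃₂ Y.μ₃₂
      ν     : Hom CX.N CY.N
      ν-iso : Iso ν
      ν-2   : ν ∘ CX.m₂' ≡ CY.m₂'
      ν-1   : ν ∘ CX.m₁' ≡ CY.m₁'
      κ     : Hom CX.K₁' CY.K₁'
      κ-iso : Iso κ
      κ-k   : κ ∘ CX.k₁ ≡ CY.k₁
      κ-n   : CY.n₁ ∘ κ ≡ ν ∘ CX.n₁
      θ     : Hom CX.I₂₁ CY.I₂₁
      θ-iso : Iso θ
      θ-p   : θ ∘ CX.p₁ ≡ CY.p₁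
      θ-q   : θ ∘ CX.q₁ ≡ CY.q₁ ∘ κ
      iso₁  : SpanIsoOver θ id X.μ₁ Y.μ₁

  record RuleCIso (R R' : RuleC) : Set (o ⊔ ℓ) where
    field
      φO     : Hom (OutC R) (OutC R')
      φK     : Hom (KerC R) (KerC R')
      φI     : Hom (InC R) (InC R')
      φO-iso : Iso φO
      φK-iso : Iso φK
      φI-iso : Iso φI
      out-comm : outC R' ∘ φK ≡ φO ∘ outC R
      in-comm  : inC R' ∘ φK ≡ φI ∘ inC R
      cond-equiv : ∀ {G} (p : Hom (InC R') G) → Mono p →
                   (Sat (p ∘ φI) (RuleC.cond R) → Sat p (RuleC.cond R')) ×
                   (Sat p (RuleC.cond R') → Sat (p ∘ φI) (RuleC.cond R))

{-# OPTIONS --safe #-}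

-- A composite of two rules is a two-step derivation I₂₁ ⇒ N ⇒ O₂₁ that is least among the
-- derivations restricting a given one X ⇒ H₁ ⇒ H₂: the composite rule applies at p : I₂₁ → X
-- exactly when both rules apply in sequence, with the same result H₂ and the pullback of the two
-- contexts as context (concurrency).  Hence a nested composite in either bracketing is a least
-- three-step derivation.  Both bracketings I₃₍₂₁₎ and I₍₃₂₎₁ factor through exactly those
-- subobjects of X to which X ⇒ H₁ ⇒ H₂ ⇒ H₃ restricts, so they agree, and with them contexts and
-- results.  A composite condition holds at p iff the original conditions hold at the successive
-- matches of the derivation from p, a description that does not depend on the bracketing.
module Submission where

open import Level using (Level; _⊔_; lift)
open import Data.Bool using (true; false)
open import Data.Product using (Σ; _×_; _,_; Σ-syntax; proj₁; proj₂)
open import Data.Unit.Polymorphic using (tt)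
open import Relation.Nullary using (¬_; contradiction)
open import Relation.Binary.PropositionalEquality using (_≡_; refl; sym; trans; cong; subst)
open import Defs

-- A sesqui-pushout step cannot be undone in general, since it also deletes whatever hangs on a
-- deleted part. The pushout complement required below `N` makes the first half of a composite a
-- double-pushout step, so this half can be reconstructed from its result. Inclusions of subobjects
-- are proved on generalized elements: pushouts along monomorphisms are stable under pullback, so an
-- element of a pushout splits into parts coming from either side, while effective unions turn the
-- pushout over an intersection into a subobject again. The two maps of the bijection depend on
-- chosen limits and colimits, so every law is a similarity of match pairs. It is obtained by
-- placing both pairs in one derivation, where leastness leaves room for only one up to isomorphism.

module SqPORewriting {o ℓ : Level} (𝒞 : Category o ℓ) (𝒜 : SqPOAdhesive 𝒞) where
  open Category 𝒞
  open SqPOAdhesive 𝒜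

  private variable
    A B C D E Q T X Y Z : Obj

  -- Equational reasoning, monomorphisms and generalized elements.

  infixr 5 _∙_
  _∙_ : ∀ {a} {S : Set a} {x y z : S} → x ≡ y → y ≡ z → x ≡ z
  _∙_ = trans

  infixl 7 _⟩∘_
  _⟩∘_ : {f g : Hom B C} → f ≡ g → (x : Hom A B) → f ∘ x ≡ g ∘ x
  p ⟩∘ x = cong (_∘ x) p

  infixr 6 _∘⟨_
  _∘⟨_ : (f : Hom B C) {x y : Hom A B} → x ≡ y → f ∘ x ≡ f ∘ y
  f ∘⟨ p = cong (f ∘_) p

  pull : {f : Hom B D} {g : Hom A B} {h : Hom A D} → f ∘ g ≡ h →
         (x : Hom X A) → f ∘ g ∘ x ≡ h ∘ x
  pull p x = sym assoc ∙ p ⟩∘ x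

  push : {f : Hom B D} {g : Hom A B} {h : Hom C D} {k : Hom A C} → f ∘ g ≡ h ∘ k →
         (x : Hom X A) → f ∘ g ∘ x ≡ h ∘ k ∘ x
  push p x = sym assoc ∙ p ⟩∘ x ∙ assoc

  cancel : {f : Hom B A} {g : Hom A B} → f ∘ g ≡ id → (x : Hom X A) → f ∘ g ∘ x ≡ x
  cancel p x = sym assoc ∙ p ⟩∘ x ∙ identityˡ

  PO PB : Hom A B → Hom A C → Hom B D → Hom C D → Set (o ⊔ ℓ)
  PO = IsPushout 𝒞
  PB = IsPullback 𝒞
  module PO = IsPushout
  module PB = IsPullback

  Mon : Hom A B → Set (o ⊔ ℓ)
  Mon = Mono 𝒞

  abstract
    ∘-mono : {f : Hom B C} {g : Hom A B} → Mon f → Mon g → Mon (f ∘ g)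
    ∘-mono fm gm x y e = gm x y (fm _ _ (sym assoc ∙ e ∙ assoc))

    mono-cancel : {f : Hom B C} {g : Hom A B} {h : Hom A C} → Mon h → f ∘ g ≡ h → Mon g
    mono-cancel hm e x y q = hm x y (sym (pull e x) ∙ _ ∘⟨ q ∙ pull e y)

  id-mono : Mon (id {A})
  id-mono x y e = sym identityˡ ∙ e ∙ identityˡ

  -- Morphisms into E are treated as generalized elements of E, monomorphisms as subobjects.
  infix 3 _∈_
  _∈_ : Hom T E → Hom Y E → Set ℓ
  x ∈ m = Σ[ u ∈ Hom _ _ ] m ∘ u ≡ x

  ∈-resp : {x y : Hom T E} {m : Hom Y E} → x ≡ y → x ∈ m → y ∈ m
  ∈-resp p (u , e) = u , e ∙ p

  -- Pushouts, pullbacks and unions of subobjects.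

  po-sym : {f : Hom A B} {g : Hom A C} {h : Hom B D} {k : Hom C D} → PO f g h k → PO g f k h
  po-sym po = record
    { commute   = sym (PO.commute po)
    ; universal = λ x y e → let (u , p , q) = PO.universal po y x (sym e) in u , q , p
    ; unique    = λ u v p q → PO.unique po u v q p }

  pb-sym : {f : Hom A B} {g : Hom A C} {h : Hom B D} {k : Hom C D} → PB f g h k → PB g f k h
  pb-sym pb = record
    { commute   = sym (PB.commute pb)
    ; universal = λ x y e → let (u , p , q) = PB.universal pb y x (sym e) in u , q , p
    ; unique    = λ u v p q → PB.unique pb u v q p }

  po-decompose : {f : Hom A B} {g : Hom A C} {h : Hom B D} {k : Hom C D}
                 {g' : Hom A X} {h' : Hom B Y} {k' : Hom X Y} {δ : Hom C X} {η : Hom D Y} →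
                 PO f g h k → PO f g' h' k' → δ ∘ g ≡ g' → η ∘ h ≡ h' → η ∘ k ≡ k' ∘ δ →
                 PO k δ η k'
  po-decompose po po' δg ηh ηk = record
    { commute   = ηk
    ; universal = λ x y e →
        let (u , uh , uk) = PO.universal po' (x ∘ _) y
              (assoc ∙ x ∘⟨ PO.commute po ∙ push e _ ∙ y ∘⟨ δg)
        in u , PO.unique po _ _ (assoc ∙ u ∘⟨ ηh ∙ uh)
                 (assoc ∙ u ∘⟨ ηk ∙ pull uk _ ∙ sym e) , uk
    ; unique    = λ u v p q → PO.unique po' u v
        (u ∘⟨ sym ηh ∙ pull p _ ∙ assoc ∙ v ∘⟨ ηh) q }

  abstract
    -- A pushout along a monomorphism is stable under pullback, so membership of ζ in a
    -- subobject can be checked separately on the two parts into which the pushout splits z.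
    po-cases : {f : Hom A B} {g : Hom A C} {h : Hom B D} {k : Hom C D} → PO f g h k → Mon f →
               (z : Hom Q D) {ζ : Hom Q E} {m : Hom Y E} → Mon m →
               (∀ {T} (y : Hom T Q) (x : Hom T B) → h ∘ x ≡ z ∘ y → ζ ∘ y ∈ m) →
               (∀ {T} (y : Hom T Q) (x : Hom T C) → k ∘ x ≡ z ∘ y → ζ ∘ y ∈ m) →
               ζ ∈ m
    po-cases {f = f} {g} {h} {k} po fm z {ζ} {m} mm onB onC
      with pullbacks z h | pullbacks z k
    ... | B' , h' , b , pbB | C' , k' , c , pbC with pullbacks b f
    ... | A' , f' , a , pbA with PB.universal pbC (h' ∘ f') (g ∘ a)
            (push (PB.commute pbB) f' ∙ h ∘⟨ PB.commute pbA ∙ push (PO.commute po) a)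
    ... | g' , k'g' , cg' with onB h' b (sym (PB.commute pbB)) | onC k' c (sym (PB.commute pbC))
    ... | uB , eB | uC , eC =
      let (u , uh , uk) = PO.universal po' uB uC (mm _ _
            (pull eB f' ∙ assoc ∙ ζ ∘⟨ PO.commute po' ∙ sym assoc ∙ sym (pull eC g')))
      in u , PO.unique po' _ _ (assoc ∙ m ∘⟨ uh ∙ eB) (assoc ∙ m ∘⟨ uk ∙ eC)
      where
      pbA' : PB g' a c g
      pbA' = record
        { commute   = cg'
        ; universal = λ x y e →
            let (v , hv , bv) = PB.universal pbB (k' ∘ x) (f ∘ y)
                  (push (PB.commute pbC) x ∙ k ∘⟨ e ∙ push (sym (PO.commute po)) y)
                (w , fw , aw) = PB.universal pbA v y bv
            in w , PB.unique pbC _ _ (pull k'g' w ∙ assoc ∙ h' ∘⟨ fw ∙ hv)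
                     (pull cg' w ∙ assoc ∙ g ∘⟨ aw ∙ sym e) , aw
        ; unique    = λ u v p q → PB.unique pbA u v
            (PB.unique pbB _ _
              (sym assoc ∙ sym k'g' ⟩∘ u ∙ assoc ∙ k' ∘⟨ p ∙ pull k'g' v ∙ assoc)
              (push (PB.commute pbA) u ∙ f ∘⟨ q ∙ push (sym (PB.commute pbA)) v)) q }
      po' : PO f' g' h' k'
      po' = proj₂ (van-Kampen po fm f' g' h' k' a b c z (sym k'g')
              (PB.commute pbA) cg' (PB.commute pbB) (PB.commute pbC) pbA pbA') (pbB , pbC)

    -- The van Kampen property is applied to the cube over this square whose top face is the trivial
    -- pushout of `id` and `g`. Its back face over `f` is a pullback because `f` is monic; a front
    -- face is the required square.
    po-pb : {f : Hom A B} {g : Hom A C} {h : Hom B D} {k : Hom C D} → PO f g h k → Mon f → PB f g h k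
    po-pb {f = f} {g} {h} {k} po fm = pb-sym (proj₁ (proj₁
      (van-Kampen po fm id g g id id f id k
        (identityʳ ∙ sym identityˡ)
        refl (identityˡ ∙ sym identityʳ) (sym (PO.commute po)) refl
        (record { commute   = refl
                ; universal = λ x y e → y , identityˡ ∙ sym (fm _ _ e) , identityˡ
                ; unique    = λ u v p _ → id-mono u v p })
        (record { commute   = identityˡ ∙ sym identityʳ
                ; universal = λ x y e → y , sym e ∙ identityˡ , identityˡ
                ; unique    = λ u v _ q → id-mono u v q }))
      (record { commute   = identityʳ ∙ sym identityˡ
              ; universal = λ x y e → y , sym e ∙ identityʳ , identityʳ
              ; unique    = λ u v _ q → sym identityʳ ∙ q ∙ identityʳ })))

    -- With `k` monic the second component of a lift is forced by the square, so it is enough to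
    -- lift into the subobject `f`.
    mkPB : {f : Hom A B} {g : Hom A C} {h : Hom B D} {k : Hom C D} → h ∘ f ≡ k ∘ g →
           Mon f → Mon k → (∀ {T} (x : Hom T B) (y : Hom T C) → h ∘ x ≡ k ∘ y → x ∈ f) → PB f g h k
    mkPB {h = h} c fm km meet = record
      { commute   = c
      ; universal = λ x y e → let (u , p) = meet x y e in
          u , p , km _ _ (push (sym c) u ∙ h ∘⟨ p ∙ e)
      ; unique    = λ u v p _ → fm u v p }

  module _ {f : Hom A B} {g : Hom A C} {b : Hom B E} {c : Hom C E}
           (pb : PB f g b c) (bm : Mon b) (cm : Mon c) where
    private
      fm : Mon f
      fm = mono-pullback-stable pb cm
      gm : Mon g
      gm = mono-pullback-stable (pb-sym pb) bm

    abstract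
      union-mono : {h : Hom B D} {k : Hom C D} → PO f g h k →
                   (u : Hom D E) → u ∘ h ≡ b → u ∘ k ≡ c → Mon u
      union-mono po u = effective-unions f g _ _ b c u fm gm bm cm po pb

      -- The pushout over the intersection embeds into `E` as the union of `b` and `c`. Applied to
      -- this subobject, the hypothesis makes the embedding split epi, so `E` inherits the universal
      -- property.
      union-po : (∀ {Y} (m : Hom Y E) → Mon m → b ∈ m → c ∈ m → id ∈ m) → PO f g b c
      union-po cover with pushouts-along-mono f g fm
      ... | D , h , k , po with PO.universal po b c (PB.commute pb)
      ... | u , uh , uk with cover u (union-mono po u uh uk) (h , uh) (k , uk)
      ... | s , us = record
        { commute   = PB.commute pb
        ; universal = λ x y e → let (v , vh , vk) = PO.universal po x y e in
            v ∘ s , assoc ∙ v ∘⟨ sb ∙ vh , assoc ∙ v ∘⟨ sc ∙ vk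
        ; unique    = λ p q pb' pc → sym identityʳ ∙ p ∘⟨ sym us ∙
            push (PO.unique po (p ∘ u) (q ∘ u)
              (assoc ∙ p ∘⟨ uh ∙ pb' ∙ sym (assoc ∙ q ∘⟨ uh))
              (assoc ∙ p ∘⟨ uk ∙ pc ∙ sym (assoc ∙ q ∘⟨ uk))) s
            ∙ q ∘⟨ us ∙ identityʳ }
        where
        um : Mon u
        um = union-mono po u uh uk
        sb : s ∘ b ≡ h
        sb = um _ _ (cancel us b ∙ sym uh)
        sc : s ∘ c ≡ k
        sc = um _ _ (cancel us c ∙ sym uk)

  -- Sesqui-pushout steps and their morphisms.

  module R = Rule

  -- A sesqui-pushout step from X to H.  As d is monic, the final pullback complement of inL
  -- and b amounts to meet and final: d is terminal among the morphisms into X that meet the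
  -- match b only inside inL.
  record Step (r : Rule 𝒞) (X : Obj) : Set (o ⊔ ℓ) where
    field
      b      : Hom (R.In r) X
      b-mono : Mon b
      Ctx    : Obj
      k      : Hom (R.Ker r) Ctx
      d      : Hom Ctx X
      d-mono : Mon d
      sq     : b ∘ R.inL r ≡ d ∘ k
      meet   : ∀ {T} (x : Hom T (R.In r)) (y : Hom T Ctx) → b ∘ x ≡ d ∘ y → x ∈ R.inL r
      final  : ∀ {Q} (z : Hom Q X) →
               (∀ {T} (x : Hom T (R.In r)) (y : Hom T Q) → b ∘ x ≡ z ∘ y → x ∈ R.inL r) → z ∈ d
      H      : Obj
      a      : Hom (R.Out r) H
      e      : Hom Ctx H
      po     : PO (R.outL r) k a e

    k-mono : Mon k
    k-mono = mono-cancel (∘-mono b-mono (R.inL-mono r)) (sym sq)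
    a-mono : Mon a
    a-mono = mono-pushout-stable (po-sym po) k-mono
    e-mono : Mon e
    e-mono = mono-pushout-stable po (R.outL-mono r)
    pb : PB (R.outL r) k a e
    pb = po-pb po (R.outL-mono r)

  module _ {r : Rule 𝒞} where
    record StepMor (S : Step r X) (S' : Step r Y) (f : Hom X Y) : Set (o ⊔ ℓ) where
      private
        module S  = Step S
        module S' = Step S'
      field
        δ   : Hom S.Ctx S'.Ctx
        η   : Hom S.H S'.H
        f-b : f ∘ S.b ≡ S'.b
        d-δ : S'.d ∘ δ ≡ f ∘ S.d
        η-a : η ∘ S.a ≡ S'.a
        η-e : η ∘ S.e ≡ S'.e ∘ δ

    open StepMor public

    module _ {S : Step r X} {S' : Step r Y} {f : Hom X Y} where
      private
        module S  = Step S
        module S' = Step S'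

      -- As `f` is monic and carries match to match, `f ∘ S.d` meets the match of `S'` only inside
      -- `inL`. Finality of the context of `S'` gives `δ`, and the pushout gives `η`.
      mkMor : Mon f → f ∘ S.b ≡ S'.b → StepMor S S' f
      mkMor fm fb = record { δ = proj₁ δ' ; η = proj₁ η' ; f-b = fb ; d-δ = proj₂ δ'
                           ; η-a = proj₁ (proj₂ η') ; η-e = proj₂ (proj₂ η') }
        where
        δ' = S'.final (f ∘ S.d) λ x y e → S.meet x y (fm _ _ (pull fb x ∙ e ∙ assoc))
        η' = PO.universal S.po S'.a (S'.e ∘ proj₁ δ')
               (PO.commute S'.po ∙ S'.e ∘⟨ S'.d-mono _ _
                 (sym S'.sq ∙ sym fb ⟩∘ _ ∙ assoc ∙ f ∘⟨ S.sq ∙ sym assoc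
                  ∙ sym (proj₂ δ') ⟩∘ _ ∙ assoc) ∙ sym assoc)

      module _ (m : StepMor S S' f) where
        δ-k : δ m ∘ S.k ≡ S'.k
        δ-k = S'.d-mono _ _ (push (d-δ m) S.k ∙ f ∘⟨ sym S.sq ∙ pull (f-b m) _ ∙ S'.sq)

        -- What lands in the context of `S'` meets its match only inside `inL`, so finality of the
        -- context of `S` applies. Thus the context of `S` is the preimage under `f` of that of
        -- `S'`.
        restrict : (x : Hom T X) (y : Hom T S'.Ctx) → f ∘ x ≡ S'.d ∘ y → x ∈ S.d
        restrict x y e = S.final x λ w v e' →
          S'.meet w (y ∘ v) (sym (pull (f-b m) w) ∙ f ∘⟨ e' ∙ push e v)

        δ-restrict : {x : Hom T S.Ctx} {y : Hom T S'.Ctx} → f ∘ S.d ∘ x ≡ S'.d ∘ y → δ m ∘ x ≡ y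
        δ-restrict {x = x} e = S'.d-mono _ _ (push (d-δ m) x ∙ e)

        η-po : PO S.e (δ m) (η m) S'.e
        η-po = po-decompose S.po S'.po δ-k (η-a m) (η-e m)

        η-restrict : (x : Hom T S.H) (y : Hom T S'.Ctx) → η m ∘ x ≡ S'.e ∘ y → x ∈ S.e
        η-restrict x y e = let (u , p , _) = PB.universal (po-pb η-po S.e-mono) x y e in u , p

        δ-mono : Mon f → Mon (δ m)
        δ-mono fm = mono-cancel (∘-mono fm S.d-mono) (d-δ m)

        η-mono : Mon f → Mon (η m)
        η-mono fm = mono-pushout-stable (po-sym η-po) (δ-mono fm)

    module _ {S : Step r X} {S' : Step r Y} {f f' : Hom X Y}
             (m : StepMor S S' f) (m' : StepMor S S' f') where
      δ-unique : f ≡ f' → δ m ≡ δ m'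
      δ-unique refl = Step.d-mono S' _ _ (d-δ m ∙ sym (d-δ m'))

      η-unique : f ≡ f' → η m ≡ η m'
      η-unique eq = PO.unique (Step.po S) _ _ (η-a m ∙ sym (η-a m'))
        (η-e m ∙ Step.e S' ∘⟨ δ-unique eq ∙ sym (η-e m'))

    infixr 9 _⊚_
    _⊚_ : {S : Step r X} {S' : Step r Y} {S'' : Step r Z} {f : Hom X Y} {g : Hom Y Z} →
          StepMor S' S'' g → StepMor S S' f → StepMor S S'' (g ∘ f)
    _⊚_ {f = f} {g} n m = record
      { δ   = δ n ∘ δ m
      ; η   = η n ∘ η m
      ; f-b = assoc ∙ g ∘⟨ f-b m ∙ f-b n
      ; d-δ = push (d-δ n) (δ m) ∙ g ∘⟨ d-δ m ∙ sym assoc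
      ; η-a = assoc ∙ η n ∘⟨ η-a m ∙ η-a n
      ; η-e = assoc ∙ η n ∘⟨ η-e m ∙ push (η-e n) (δ m) }

    idMor : {S : Step r X} → StepMor S S id
    idMor = record
      { δ = id ; η = id ; f-b = identityˡ ; d-δ = identityʳ ∙ sym identityˡ ; η-a = identityˡ
      ; η-e = identityˡ ∙ sym identityʳ }

  -- Final pullback complements and double-pushout steps.

  module _ {K I X D : Obj} {i : Hom K I} {b : Hom I X} {k : Hom K D} {d : Hom D X} where
    -- An element of `z` lies in `d` or in `b`; in the second case `avoid` puts it into `i`, and `k`
    -- takes it to `d`. Hence pushout complements are final pullback complements.
    po-final : PO i k b d → Mon i → Mon d → (z : Hom Q X) →
               (∀ {T} (x : Hom T I) (y : Hom T Q) → b ∘ x ≡ z ∘ y → x ∈ i) → z ∈ d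
    po-final po im dm z avoid = po-cases po im z dm
      (λ y x e → let (w , p) = avoid x y e in k ∘ w , push (sym (PO.commute po)) w ∙ b ∘⟨ p ∙ e)
      (λ y x e → x , e)

    module _ (im : Mon i) (bm : Mon b) (fpc : IsFPC 𝒞 i b k d) where
      private
        module F = IsFPC fpc
        module Fpb = IsPullback F.pullback

      fpc-meet : (x : Hom T I) (y : Hom T D) → b ∘ x ≡ d ∘ y → x ∈ i
      fpc-meet x y e = let (w , p , _) = Fpb.universal x y e in w , p

      -- If `d ∘ u ≡ d ∘ v`, then `u` and `v` solve the same factorization problem, posed by the
      -- pullback of `b` along `d ∘ u`: they agree on it since `i` is monic, and uniqueness
      -- identifies them.
      fpc-mono : Mon d
      fpc-mono u v e with pullbacks b (d ∘ u)
      ... | P , x , y , pb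
          with Fpb.universal x (u ∘ y) (PB.commute pb ∙ assoc)
             | Fpb.universal x (v ∘ y) (PB.commute pb ∙ e ⟩∘ y ∙ assoc)
      ... | w , iw , kw | w' , iw' , kw' =
        F.unique x y (d ∘ u) pb w iw u v refl (sym kw) (sym e)
          (sym (k ∘⟨ im _ _ (iw ∙ sym iw') ∙ kw'))

      fpc-final : (z : Hom Q X) →
                  (∀ {T} (x : Hom T I) (y : Hom T Q) → b ∘ x ≡ z ∘ y → x ∈ i) → z ∈ d
      fpc-final z avoid with pullbacks b z
      ... | P , x , y , pb with avoid x y (PB.commute pb)
      ... | w , iw = let (u , p , _) = F.universal x y z pb w iw in u , p

  module _ {r : Rule 𝒞} where
    mkStep : (b : Hom (R.In r) X) → Mon b → Step r X
    mkStep b bm =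
      let (D , k , d , fpc , _ , dm) = fpcs (R.inL r) b (R.inL-mono r) bm
          (H , a , e , po)           = pushouts-along-mono (R.outL r) k (R.outL-mono r)
      in record
      { b = b ; b-mono = bm ; Ctx = D ; k = k ; d = d ; d-mono = dm
      ; sq    = IsPullback.commute (IsFPC.pullback fpc)
      ; meet  = fpc-meet (R.inL-mono r) bm fpc
      ; final = fpc-final (R.inL-mono r) bm fpc
      ; H = H ; a = a ; e = e ; po = po }

    step-fpc : (S : Step r X) → let open Step S in IsFPC 𝒞 (R.inL r) b k d
    step-fpc S = record
      { pullback  = mkPB sq (R.inL-mono r) d-mono meet
      ; universal = λ x y z pb w e →
          let (u , p) = final z λ x' y' e' →
                let (v , q , _) = PB.universal pb x' y' e' in w ∘ v , pull e v ∙ q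
          in u , p , d-mono _ _ (pull p y ∙ sym (PB.commute pb) ∙ b ∘⟨ sym e ∙ push sq w)
      ; unique    = λ x y z pb w e u v p _ q _ → d-mono u v (p ∙ sym q) }
      where open Step S

    dpoStep : {K' O' I' : Obj} {k : Hom (R.Ker r) K'} {m : Hom (R.Out r) O'} {n : Hom K' O'}
              {q : Hom K' I'} {p : Hom (R.In r) I'} →
              PO (R.outL r) k m n → PO k (R.inL r) q p → Mon k → Step r I'
    dpoStep {k = k} {m} {n} {q} {p} poc po km = record
      { b = p ; b-mono = mono-pushout-stable po km ; k = k ; d = q ; d-mono = qm
      ; sq    = sym (PO.commute po)
      ; meet  = λ x y e → let (w , i , _) = PB.universal (po-pb (po-sym po) (R.inL-mono r)) x y e
                          in w , i
      ; final = po-final (po-sym po) (R.inL-mono r) qm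
      ; a = m ; e = n ; po = poc }
      where
      qm : Mon q
      qm = mono-pushout-stable (po-sym po) (R.inL-mono r)

    abstract
      -- When the left square of T is a pushout, T can be undone: its source embeds into that of S
      -- as soon as its result does.
      step-reflect : (T : Step r Y) (S : Step r X) → PO (Step.k T) (R.inL r) (Step.d T) (Step.b T) →
                     (h : Hom (Step.H T) (Step.H S)) → Mon h → h ∘ Step.a T ≡ Step.a S →
                     Σ[ p ∈ Hom Y X ] (Mon p × Σ[ m ∈ StepMor T S p ] η m ≡ h)
      step-reflect {Y = Y} {X = X} T S left h hm ha =
        p , union-mono pbI (∘-mono S.d-mono δm) S.b-mono left p pd pb
          , record { δ = δ' ; η = h ; f-b = pb ; d-δ = sym pd ; η-a = ha ; η-e = sym eδ }
          , refl
        where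
        module S = Step S
        module T = Step T
        -- The right-hand square of `S` is a pushout, so `S.e` is final for `outL` and `S.a`, and
        -- the contexts can be compared from the result side.
        hT : Σ[ u ∈ Hom T.Ctx S.Ctx ] S.e ∘ u ≡ h ∘ T.e
        hT = po-final S.po (R.outL-mono r) S.e-mono (h ∘ T.e) λ x y e →
          let (w , i , _) = PB.universal T.pb x y (hm _ _ (pull ha x ∙ e ∙ assoc)) in w , i
        δ' : Hom T.Ctx S.Ctx
        δ' = proj₁ hT
        eδ : S.e ∘ δ' ≡ h ∘ T.e
        eδ = proj₂ hT
        δm : Mon δ'
        δm = mono-cancel (∘-mono hm T.e-mono) eδ
        δk : δ' ∘ T.k ≡ S.k
        δk = S.e-mono _ _ (push eδ T.k ∙ h ∘⟨ sym (PO.commute T.po) ∙ pull ha _ ∙ PO.commute S.po)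
        sq : (S.d ∘ δ') ∘ T.k ≡ S.b ∘ R.inL r
        sq = assoc ∙ S.d ∘⟨ δk ∙ sym S.sq
        pbI : PB T.k (R.inL r) (S.d ∘ δ') S.b
        pbI = mkPB sq T.k-mono S.b-mono λ x y e →
          let (w , i) = S.meet y (δ' ∘ x) (sym e ∙ assoc)
          in w , ∘-mono S.d-mono δm _ _ (assoc ∙ S.d ∘⟨ pull δk w
                 ∙ push (sym S.sq) w ∙ S.b ∘⟨ i ∙ sym e)
        pp : Σ[ u ∈ Hom Y X ] (u ∘ T.d ≡ S.d ∘ δ' × u ∘ T.b ≡ S.b)
        pp = PO.universal left (S.d ∘ δ') S.b sq
        p : Hom Y X
        p = proj₁ pp
        pd : p ∘ T.d ≡ S.d ∘ δ'
        pd = proj₁ (proj₂ pp)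
        pb : p ∘ T.b ≡ S.b
        pb = proj₂ (proj₂ pp)

    record DPORestriction (N : Obj) (m : Hom (R.Out r) N) : Set (o ⊔ ℓ) where
      field
        K' I'  : Obj
        k      : Hom (R.Ker r) K'
        n      : Hom K' N
        q      : Hom K' I'
        p      : Hom (R.In r) I'
        poc    : PO (R.outL r) k m n
        po     : PO k (R.inL r) q p
        n-mono : Mon n
        k-mono : Mon k

    abstract
      -- A subobject of the result that contains the right-hand side of the rule arises by a
      -- double-pushout step.
      dpo-restrict : (S : Step r X) {N : Obj} (m : Hom (R.Out r) N) (h : Hom N (Step.H S)) → Mon h →
                     h ∘ m ≡ Step.a S → DPORestriction N m
      dpo-restrict S m h hm ha with pullbacks h (Step.e S)
      ... | K' , n , δ' , pbK with PB.universal pbK (m ∘ R.outL r) (Step.k S)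
                                     (pull ha _ ∙ PO.commute (Step.po S))
      ... | k , nk , δk with mono-cancel (∘-mono (mono-cancel (Step.a-mono S) ha) (R.outL-mono r)) nk
      ... | km with pushouts-along-mono k (R.inL r) km
      ... | I' , q , p , po = record
        { k = k ; n = n ; q = q ; p = p ; poc = poc ; po = po ; n-mono = nm ; k-mono = km }
        where
        module S = Step S
        mm : Mon m
        mm = mono-cancel S.a-mono ha
        nm : Mon n
        nm = mono-pullback-stable pbK S.e-mono
        -- `K'` is the part of `N` in the context of `S`. As the result of `S` is covered by `a` and
        -- `e`, `N` is covered by `m` and `n`, which meet in the kernel of the rule.
        poc : PO (R.outL r) k m n
        poc = union-po
          (mkPB (sym nk) (R.outL-mono r) nm λ x y e →
            let (w , i , _) = PB.universal S.pb x (δ' ∘ y)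
                  (sym ha ⟩∘ x ∙ assoc ∙ h ∘⟨ e ∙ push (PB.commute pbK) y)
            in w , i)
          mm nm
          λ u um (mu , me) (nu , ne) → po-cases S.po (R.outL-mono r) h um
            (λ y x e → mu ∘ x , pull me x ∙ hm _ _ (pull ha x ∙ e) ∙ sym identityˡ)
            (λ y x e → let (w , i , _) = PB.universal pbK y x (sym e)
                       in nu ∘ w , pull ne w ∙ i ∙ sym identityˡ)

  -- Two-step derivations and the concurrency theorem.

  record Mor2 {r₁ r₂ : Rule 𝒞} (S₁ : Step r₁ X) (S₂ : Step r₂ (Step.H S₁))
              (S₁' : Step r₁ Y) (S₂' : Step r₂ (Step.H S₁')) : Set (o ⊔ ℓ) where
    constructor mkMor2
    field
      f      : Hom X Y
      f-mono : Mon f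
      m₁     : StepMor S₁ S₁' f
      m₂     : StepMor S₂ S₂' (η m₁)

  infixr 9 _⊛_
  _⊛_ : {r₁ r₂ : Rule 𝒞} {S₁ : Step r₁ X} {S₂ : Step r₂ (Step.H S₁)}
        {S₁' : Step r₁ Y} {S₂' : Step r₂ (Step.H S₁')}
        {S₁'' : Step r₁ Z} {S₂'' : Step r₂ (Step.H S₁'')} →
        Mor2 S₁' S₂' S₁'' S₂'' → Mor2 S₁ S₂ S₁' S₂' → Mor2 S₁ S₂ S₁'' S₂''
  G ⊛ F = mkMor2 (Mor2.f G ∘ Mor2.f F) (∘-mono (Mor2.f-mono G) (Mor2.f-mono F))
                 (Mor2.m₁ G ⊚ Mor2.m₁ F) (Mor2.m₂ G ⊚ Mor2.m₂ F)

  module _ {r₁ r₂ : Rule 𝒞} {I : Obj} {T₁ : Step r₁ I} {T₂ : Step r₂ (Step.H T₁)}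
           {K₂₁ : Obj} {e₂ : Hom K₂₁ (Step.Ctx T₂)} {e₁ : Hom K₂₁ (Step.Ctx T₁)}
           (pbK : PB e₂ e₁ (Step.d T₂) (Step.e T₁)) where
    private
      module T₁ = Step T₁
      module T₂ = Step T₂

    module Concurrency {S₁ : Step r₁ X} {S₂ : Step r₂ (Step.H S₁)} (E : Mor2 T₁ T₂ S₁ S₂) where
      private
        module S₁ = Step S₁
        module S₂ = Step S₂
        open Mor2 E renaming (f to p ; f-mono to p-mono)
        h  = η m₁
        hm : Mon h
        hm = η-mono m₁ p-mono
        g  = η m₂
        gm : Mon g
        gm = η-mono m₂ hm
        DD = pullbacks S₁.e S₂.d
        π₁ = proj₁ (proj₂ DD)
        π₂ = proj₁ (proj₂ (proj₂ DD))
        pbD : PB π₁ π₂ S₁.e S₂.d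
        pbD = proj₂ (proj₂ (proj₂ DD))
        π₁-mono : Mon π₁
        π₁-mono = mono-pullback-stable pbD S₂.d-mono
        π₂-mono : Mon π₂
        π₂-mono = mono-pullback-stable (pb-sym pbD) S₁.e-mono
        d = S₁.d ∘ π₁
        d-mono : Mon d
        d-mono = ∘-mono S₁.d-mono π₁-mono
        e = S₂.e ∘ π₂
        e-mono : Mon e
        e-mono = ∘-mono S₂.e-mono π₂-mono
        K = PB.universal pbD (δ m₁ ∘ e₁) (δ m₂ ∘ e₂)
              (push (sym (η-e m₁)) e₁ ∙ h ∘⟨ sym (PB.commute pbK) ∙ push (sym (d-δ m₂)) e₂)
        k = proj₁ K
        π₁k : π₁ ∘ k ≡ δ m₁ ∘ e₁
        π₁k = proj₁ (proj₂ K)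
        π₂k : π₂ ∘ k ≡ δ m₂ ∘ e₂
        π₂k = proj₂ (proj₂ K)
        sq : p ∘ T₁.d ∘ e₁ ≡ d ∘ k
        sq = push (sym (d-δ m₁)) e₁ ∙ S₁.d ∘⟨ sym π₁k ∙ sym assoc

        abstract
          meet₁ : (x : Hom T T₁.Ctx) (y : Hom T (proj₁ DD)) → δ m₁ ∘ x ≡ π₁ ∘ y → x ∈ e₁
          meet₁ x y q =
            let (v , nv)     = restrict m₂ (T₁.e ∘ x) (π₂ ∘ y)
                                 (push (η-e m₁) x ∙ S₁.e ∘⟨ q ∙ push (PB.commute pbD) y)
                (w , _ , ew) = PB.universal pbK v x nv
            in w , ew

          meet : (x : Hom T I) (y : Hom T (proj₁ DD)) → p ∘ x ≡ d ∘ y → x ∈ T₁.d ∘ e₁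
          meet x y q =
            let (x' , qx) = restrict m₁ x (π₁ ∘ y) (q ∙ assoc)
                (w , ew)  = meet₁ x' y (δ-restrict m₁ (p ∘⟨ qx ∙ q ∙ assoc))
            in w , assoc ∙ T₁.d ∘⟨ ew ∙ qx

          -- By `η-restrict`, the part of the second match lying in the context of the first step
          -- has the form `T₁.e ∘ v`. Where it meets `z`, `avoid` puts `v` into the composite
          -- kernel, which the second rule preserves.
          avoid₂ : (z : Hom Q X) →
                   (∀ {T} (x : Hom T I) (y : Hom T Q) → p ∘ x ≡ z ∘ y → x ∈ T₁.d ∘ e₁) →
                   (z₁ : Hom Q S₁.Ctx) → S₁.d ∘ z₁ ≡ z →
                   (x : Hom T (R.In r₂)) (y : Hom T Q) → S₂.b ∘ x ≡ (S₁.e ∘ z₁) ∘ y → x ∈ R.inL r₂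
          avoid₂ z avoid z₁ dz₁ x y q =
            let hx = pull (f-b m₂) x ∙ q ∙ assoc
                (v , nv) = η-restrict m₁ (T₂.b ∘ x) (z₁ ∘ y) hx
                δv = S₁.e-mono _ _ (push (sym (η-e m₁)) v ∙ h ∘⟨ nv ∙ hx)
                (w , i) = avoid (T₁.d ∘ v) y (push (sym (d-δ m₁)) v ∙ S₁.d ∘⟨ δv ∙ pull dz₁ y)
                ew = T₁.d-mono _ _ (sym assoc ∙ i)
            in T₂.meet x (e₂ ∘ w)
                 (sym nv ∙ T₁.e ∘⟨ sym ew ∙ push (sym (PB.commute pbK)) w)

          final₁ : (z : Hom Q X) →
                   (∀ {T} (x : Hom T I) (y : Hom T Q) → p ∘ x ≡ z ∘ y → x ∈ T₁.d ∘ e₁) →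
                   z ∈ S₁.d
          final₁ z avoid = S₁.final z λ x y q →
            let (w , i) = avoid (T₁.b ∘ x) y (pull (f-b m₁) x ∙ q)
            in T₁.meet x (e₁ ∘ w) (sym i ∙ assoc)

          final₂ : (z : Hom Q X) →
                   (∀ {T} (x : Hom T I) (y : Hom T Q) → p ∘ x ≡ z ∘ y → x ∈ T₁.d ∘ e₁) →
                   (z₁ : Hom Q S₁.Ctx) → S₁.d ∘ z₁ ≡ z → S₁.e ∘ z₁ ∈ S₂.d
          final₂ z avoid z₁ dz₁ = S₂.final (S₁.e ∘ z₁) (avoid₂ z avoid z₁ dz₁)

          glue : {z : Hom Q X} {z₁ : Hom Q S₁.Ctx} → S₁.d ∘ z₁ ≡ z → S₁.e ∘ z₁ ∈ S₂.d → z ∈ d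
          glue {z₁ = z₁} dz₁ (z₂ , dz₂) =
            let (u , πu , _) = PB.universal pbD z₁ z₂ (sym dz₂) in u , assoc ∙ S₁.d ∘⟨ πu ∙ dz₁

          final : (z : Hom Q X) →
                  (∀ {T} (x : Hom T I) (y : Hom T Q) → p ∘ x ≡ z ∘ y → x ∈ T₁.d ∘ e₁) →
                  z ∈ d
          final z avoid = let (z₁ , dz₁) = final₁ z avoid in glue dz₁ (final₂ z avoid z₁ dz₁)

          meet' : (x : Hom T T₂.H) (y : Hom T (proj₁ DD)) → g ∘ x ≡ e ∘ y → x ∈ T₂.e ∘ e₂
          meet' x y q =
            let (x' , jx)    = η-restrict m₂ x (π₂ ∘ y) (q ∙ assoc)
                δx           = S₂.e-mono _ _ (push (sym (η-e m₂)) x' ∙ g ∘⟨ jx ∙ q ∙ assoc)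
                (v , nv)     = η-restrict m₁ (T₂.d ∘ x') (π₁ ∘ y)
                                 (push (sym (d-δ m₂)) x' ∙ S₂.d ∘⟨ δx ∙ push (sym (PB.commute pbD)) y)
                (w , ew , _) = PB.universal pbK x' v (sym nv)
            in w , assoc ∙ T₂.e ∘⟨ ew ∙ jx

          sq' : g ∘ T₂.e ∘ e₂ ≡ e ∘ k
          sq' = push (η-e m₂) e₂ ∙ S₂.e ∘⟨ sym π₂k ∙ sym assoc

          -- The result `S₂.H` is covered by `S₂.a`, which lies in `g`, and by its context. Seen in
          -- `S₁.H`, a piece of that context either comes from the output of the first rule, hence
          -- from `T₁.H` and again from `g`, or it survives the first step too and so lies in `e`.
          cover : (m : Hom Y S₂.H) → Mon m → g ∈ m → e ∈ m → id ∈ m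
          cover m mm (mg , gg) (me , ee) = po-cases S₂.po (R.outL-mono r₂) id mm
            (λ y x q → mg ∘ T₂.a ∘ x , pull gg _ ∙ pull (η-a m₂) x ∙ q)
            (λ y x q → ∈-resp q (po-cases S₁.po (R.outL-mono r₁) (S₂.d ∘ x) mm
              (λ y' v q' → let (w , nw) = restrict m₂ (T₁.a ∘ v) (x ∘ y')
                                            (pull (η-a m₁) v ∙ q' ∙ assoc)
                           in mg ∘ T₂.e ∘ w , pull gg _ ∙ push (η-e m₂) w
                                ∙ S₂.e ∘⟨ δ-restrict m₂ (h ∘⟨ nw ∙ pull (η-a m₁) v ∙ q' ∙ assoc)
                                ∙ sym assoc)
              (λ y' v q' → let (w , _ , πw) = PB.universal pbD v (x ∘ y') (q' ∙ assoc)
                           in me ∘ w , pull ee w ∙ assoc ∙ S₂.e ∘⟨ πw ∙ sym assoc)))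

      -- The concurrency theorem: two consecutive steps are one step of the composite rule.
      conc : (om : Mon (T₂.e ∘ e₂)) (im : Mon (T₁.d ∘ e₁)) →
             Step (mkRule T₂.H K₂₁ I (T₂.e ∘ e₂) (T₁.d ∘ e₁) om im) X
      conc om im = record
        { b = p ; b-mono = p-mono ; k = k ; d = d ; d-mono = d-mono ; sq = sq ; meet = meet
        ; final = final ; H = S₂.H ; a = g ; e = e
        ; po = union-po (mkPB sq' om e-mono meet') gm e-mono cover }

      conc-pb : PB π₁ π₂ S₁.e S₂.d
      conc-pb = pbD

      module _ (om : Mon (T₂.e ∘ e₂)) (im : Mon (T₁.d ∘ e₁)) where
        private module S = Step (conc om im)

        conc-split : (x : Hom T S.Ctx) → Σ[ x₁ ∈ Hom T S₁.Ctx ] Σ[ x₂ ∈ Hom T S₂.Ctx ]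
                     (S₁.e ∘ x₁ ≡ S₂.d ∘ x₂ × S.d ∘ x ≡ S₁.d ∘ x₁ × S.e ∘ x ≡ S₂.e ∘ x₂)
        conc-split x = π₁ ∘ x , π₂ ∘ x , push (PB.commute pbD) x , assoc , assoc

        conc-lift : (x₁ : Hom T S₁.Ctx) (x₂ : Hom T S₂.Ctx) → S₁.e ∘ x₁ ≡ S₂.d ∘ x₂ →
                    Σ[ x ∈ Hom T S.Ctx ] (S.d ∘ x ≡ S₁.d ∘ x₁ × S.e ∘ x ≡ S₂.e ∘ x₂)
        conc-lift x₁ x₂ q = let (x , p₁ , p₂) = PB.universal pbD x₁ x₂ q
                            in x , assoc ∙ S₁.d ∘⟨ p₁ , assoc ∙ S₂.e ∘⟨ p₂

      -- The composite match is the least subobject of X on which both steps can be performed.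
      factor : PO T₁.k (R.inL r₁) T₁.d T₁.b →
               {M : Obj} {sl : Hom M (R.In r₂)} {sr : Hom M (R.Out r₁)} → Mon sl →
               PO sl sr T₂.b T₁.a →
               {S₁' : Step r₁ Y} {S₂' : Step r₂ (Step.H S₁')} (G : Mor2 S₁' S₂' S₁ S₂) →
               Σ[ E' ∈ Mor2 T₁ T₂ S₁' S₂' ] Mor2.f G ∘ Mor2.f E' ≡ p
      factor left slm joint {S₁' = S₁'} {S₂'} G =
        record { f = p' ; f-mono = p'm ; m₁ = m₁' ; m₂ = mkMor (η-mono m₁' p'm)
                   (η-mono G.m₁ G.f-mono _ _ (pull (η-unique (G.m₁ ⊚ m₁') m₁ gp) _
                     ∙ f-b m₂ ∙ sym (f-b G.m₂))) }
        , gp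
        where
        module G = Mor2 G
        module S₁' = Step S₁'
        module S₂' = Step S₂'
        p∈g : p ∈ G.f
        -- Elements of the first match are in `G.f` through the match of `S₁'`. An element of the
        -- context of `T₁` is inspected in `T₁.H`: if it is in the second match, `η-restrict` pulls
        -- its occurrence in `S₁'.H` back to the context of `S₁'`; if it is in the output of the
        -- first rule, it lies in the kernel, hence in the first match.
        p∈g = po-cases left T₁.k-mono id G.f-mono
          (λ y x q → ∈-resp (p ∘⟨ (q ∙ identityˡ))
            (po-cases joint slm (T₁.e ∘ x) G.f-mono
              (λ y' v q' →
                let eq = push (sym (η-e m₁)) (x ∘ y') ∙ h ∘⟨ (sym assoc ∙ sym q') ∙ pull (f-b m₂) v
                    (v' , ev) = η-restrict G.m₁ (S₂'.b ∘ v) (δ m₁ ∘ x ∘ y')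
                                  (pull (f-b G.m₂) v ∙ sym eq)
                    δv = S₁.e-mono _ _ (push (sym (η-e G.m₁)) v'
                           ∙ η G.m₁ ∘⟨ ev ∙ pull (f-b G.m₂) v ∙ sym eq)
                in S₁'.d ∘ v' , push (sym (d-δ G.m₁)) v' ∙ S₁.d ∘⟨ δv ∙ push (d-δ m₁) (x ∘ y')
                     ∙ sym (assoc ∙ p ∘⟨ assoc))
              (λ y' v q' →
                let (w , _ , kw) = PB.universal T₁.pb v (x ∘ y') (q' ∙ assoc)
                in S₁'.b ∘ R.inL r₁ ∘ w , pull (f-b G.m₁) _ ∙ sym (f-b m₁) ⟩∘ _ ∙ assoc
                     ∙ p ∘⟨ push T₁.sq w ∙ p ∘⟨ T₁.d ∘⟨ kw
                     ∙ sym (assoc ∙ p ∘⟨ assoc))))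
          (λ y x q → S₁'.b ∘ x , pull (f-b G.m₁) x ∙ sym (f-b m₁) ⟩∘ x ∙ assoc
            ∙ p ∘⟨ (q ∙ identityˡ))
        p' = proj₁ p∈g
        gp : G.f ∘ p' ≡ p
        gp = proj₂ p∈g
        p'm : Mon p'
        p'm = mono-cancel p-mono gp
        m₁' : StepMor T₁ S₁' p'
        m₁' = mkMor p'm (G.f-mono _ _ (pull gp _ ∙ f-b m₁ ∙ sym (f-b G.m₁)))

    module _ {S₁ : Step r₁ X} {S₂ : Step r₂ (Step.H S₁)}
             {S₁' : Step r₁ Y} {S₂' : Step r₂ (Step.H S₁')}
             (E : Mor2 T₁ T₂ S₁ S₂) (E' : Mor2 T₁ T₂ S₁' S₂') (G : Mor2 S₁ S₂ S₁' S₂')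
             (eq : Mor2.f G ∘ Mor2.f E ≡ Mor2.f E')
             (om : Mon (T₂.e ∘ e₂)) (im : Mon (T₁.d ∘ e₁)) where
      private
        module G = Mor2 G
        S  = Concurrency.conc E om im
        S' = Concurrency.conc E' om im
        pb  = Concurrency.conc-pb E
        pb' = Concurrency.conc-pb E'
        dd = PB.universal pb' (δ G.m₁ ∘ _) (δ G.m₂ ∘ _)
               (push (sym (η-e G.m₁)) _ ∙ η G.m₁ ∘⟨ PB.commute pb ∙ push (sym (d-δ G.m₂)) _)

      conc-mor : StepMor S S' G.f
      conc-mor = record
        { δ = proj₁ dd ; η = η G.m₂ ; f-b = eq
        ; d-δ = assoc ∙ Step.d S₁' ∘⟨ proj₁ (proj₂ dd) ∙ push (d-δ G.m₁) _
        ; η-a = η-unique (G.m₂ ⊚ Mor2.m₂ E) (Mor2.m₂ E')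
                  (η-unique (G.m₁ ⊚ Mor2.m₁ E) (Mor2.m₁ E') eq)
        ; η-e = push (η-e G.m₂) _ ∙ Step.e S₂' ∘⟨ sym (proj₂ (proj₂ dd)) ∙ sym assoc }

  -- Composites of rules and their occurrences in derivations.

  module _ {R₂ R₁ : RuleC 𝒞} {μ : Span 𝒞 (InC 𝒞 R₂) (OutC 𝒞 R₁)} (C : Comp 𝒞 R₂ R₁ μ) where
    open Comp C
    private
      r₁ = RuleC.rl R₁
      r₂ = RuleC.rl R₂
      m₁'-mono : Mon m₁'
      m₁'-mono = mono-pushout-stable po-N (Span.sl-mono μ)
      m₂'-mono : Mon m₂'
      m₂'-mono = mono-pushout-stable (po-sym po-N) (Span.sr-mono μ)

    -- A composite is itself a two-step derivation I₂₁ ⇒ N ⇒ O₂₁.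
    first : Step r₁ I₂₁
    first = dpoStep poc-K₁ po-I
      (mono-cancel (∘-mono m₁'-mono (R.outL-mono r₁)) (sym (PO.commute poc-K₁)))

    second : Step r₂ N
    second = record
      { b = m₂' ; b-mono = m₂'-mono ; k = k₂ ; d = n₂
      ; d-mono = fpc-mono (R.inL-mono r₂) m₂'-mono fpc-K₂
      ; sq     = IsPullback.commute (IsFPC.pullback fpc-K₂)
      ; meet   = fpc-meet (R.inL-mono r₂) m₂'-mono fpc-K₂
      ; final  = fpc-final (R.inL-mono r₂) m₂'-mono fpc-K₂
      ; a = j₂ ; e = jK ; po = po-O }

    Emb : (S₁ : Step r₁ X) (S₂ : Step r₂ (Step.H S₁)) → Set (o ⊔ ℓ)
    Emb S₁ S₂ = Mor2 first second S₁ S₂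

    emb : (S₁ : Step r₁ X) (S₂ : Step r₂ (Step.H S₁)) (h : Hom N (Step.H S₁)) → Mon h →
          h ∘ m₁' ≡ Step.a S₁ → h ∘ m₂' ≡ Step.b S₂ → Emb S₁ S₂
    emb S₁ S₂ h hm h₁ h₂ =
      let (p , pm , m , eq) = step-reflect first S₁ po-I h hm h₁
      in mkMor2 p pm m (mkMor (η-mono m pm) (eq ⟩∘ m₂' ∙ h₂))

    emb-η : (S₁ : Step r₁ X) (S₂ : Step r₂ (Step.H S₁)) (h : Hom N (Step.H S₁)) (hm : Mon h)
            (h₁ : h ∘ m₁' ≡ Step.a S₁) (h₂ : h ∘ m₂' ≡ Step.b S₂) →
            η (Mor2.m₁ (emb S₁ S₂ h hm h₁ h₂)) ≡ h
    emb-η S₁ S₂ h hm h₁ h₂ = proj₂ (proj₂ (proj₂ (step-reflect first S₁ po-I h hm h₁)))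

  module _ {R₁ R₂ : RuleC 𝒞} {μ : Span 𝒞 (InC 𝒞 R₂) (OutC 𝒞 R₁)} {N : Obj}
           (T₂ : Step (RuleC.rl R₂) N) {m₁' : Hom (OutC 𝒞 R₁) N}
           (po-N : PO (Span.sl μ) (Span.sr μ) (Step.b T₂) m₁')
           (D : DPORestriction {r = RuleC.rl R₁} N m₁') where
    private
      module D = DPORestriction D
      module T₂ = Step T₂

    composite : Comp 𝒞 R₂ R₁ μ
    composite =
      let (K , e₂ , e₁ , pbK) = pullbacks T₂.d D.n in record
      { po-N = po-N ; fpc-K₂ = step-fpc T₂ ; poc-K₁ = D.poc ; po-O = T₂.po
      ; po-I = D.po ; pb-K = pbK
      ; out-mono = ∘-mono T₂.e-mono (mono-pullback-stable pbK D.n-mono)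
      ; in-mono  = ∘-mono (mono-pushout-stable (po-sym D.po) (R.inL-mono (RuleC.rl R₁)))
                          (mono-pullback-stable (pb-sym pbK) T₂.d-mono) }

    compose-with : (S₁ : Step (RuleC.rl R₁) X) (S₂ : Step (RuleC.rl R₂) (Step.H S₁))
                   (h : Hom N (Step.H S₁)) → Mon h → h ∘ m₁' ≡ Step.a S₁ →
                   h ∘ T₂.b ≡ Step.b S₂ → Σ[ C ∈ Comp 𝒞 R₂ R₁ μ ] Emb C S₁ S₂
    compose-with S₁ S₂ h hm h₁ h₂ = composite , emb composite S₁ S₂ h hm h₁ h₂

  abstract
    -- The overlap is the intersection of the second input with the first output inside the middle
    -- object. Their pushout `N` is then their union there, and `dpo-restrict` supplies the pushout
    -- complement that a composite requires.
    compose : (R₁ R₂ : RuleC 𝒞) (S₁ : Step (RuleC.rl R₁) X) (S₂ : Step (RuleC.rl R₂) (Step.H S₁)) →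
              Σ[ μ ∈ Span 𝒞 (InC 𝒞 R₂) (OutC 𝒞 R₁) ] Σ[ C ∈ Comp 𝒞 R₂ R₁ μ ] Emb C S₁ S₂
    compose R₁ R₂ S₁ S₂ with pullbacks (Step.b S₂) (Step.a S₁)
    ... | M , sl , sr , pbM
        with mono-pullback-stable pbM (Step.a-mono S₁)
           | mono-pullback-stable (pb-sym pbM) (Step.b-mono S₂)
    ... | slm | srm with pushouts-along-mono sl sr slm
    ... | N , m₂' , m₁' , po-N with PO.universal po-N (Step.b S₂) (Step.a S₁) (PB.commute pbM)
    ... | h , h₂ , h₁ = record { sl-mono = slm ; sr-mono = srm }
        , compose-with {R₁ = R₁} {R₂} (mkStep m₂' (mono-pushout-stable (po-sym po-N) srm)) po-N
            (dpo-restrict S₁ m₁' h hm h₁) S₁ S₂ h hm h₁ h₂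
      where
      hm : Mon h
      hm = union-mono pbM (Step.b-mono S₂) (Step.a-mono S₁) po-N h h₂ h₁

-- Three-step derivations and their two bracketings.

module Derivations {o ℓ : Level} (𝒞 : Category o ℓ) (𝒜 : SqPOAdhesive 𝒞) where
  open Category 𝒞
  open SqPOAdhesive 𝒜
  open SqPORewriting 𝒞 𝒜

  private variable
    A T X Y : Obj

  module _ {R₂ R₁ : RuleC 𝒞} {μ : Span 𝒞 (InC 𝒞 R₂) (OutC 𝒞 R₁)} (C : Comp 𝒞 R₂ R₁ μ) where
    private
      module C = Comp C
      r₁ = RuleC.rl R₁
      r₂ = RuleC.rl R₂

    composed : {S₁ : Step r₁ X} {S₂ : Step r₂ (Step.H S₁)} → Emb C S₁ S₂ → Step (compRule 𝒞 C) X
    composed E = Concurrency.conc {T₁ = first C} {second C} C.pb-K E C.out-mono C.in-mono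

    composed-mor : {S₁ : Step r₁ X} {S₂ : Step r₂ (Step.H S₁)}
                   {S₁' : Step r₁ Y} {S₂' : Step r₂ (Step.H S₁')}
                   (E : Emb C S₁ S₂) (E' : Emb C S₁' S₂') (G : Mor2 S₁ S₂ S₁' S₂') →
                   Mor2.f G ∘ Mor2.f E ≡ Mor2.f E' → StepMor (composed E) (composed E') (Mor2.f G)
    composed-mor E E' G eq = conc-mor {T₁ = first C} {second C} C.pb-K E E' G eq C.out-mono C.in-mono

    module _ {S₁ : Step r₁ X} {S₂ : Step r₂ (Step.H S₁)} (E : Emb C S₁ S₂) where
      private
        module S  = Step (composed E)
        module S₁ = Step S₁
        module S₂ = Step S₂

      composed-split : (x : Hom T S.Ctx) → Σ[ x₁ ∈ Hom T S₁.Ctx ] Σ[ x₂ ∈ Hom T S₂.Ctx ]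
                       (S₁.e ∘ x₁ ≡ S₂.d ∘ x₂ × S.d ∘ x ≡ S₁.d ∘ x₁ × S.e ∘ x ≡ S₂.e ∘ x₂)
      composed-split =
        Concurrency.conc-split {T₁ = first C} {second C} C.pb-K E C.out-mono C.in-mono

      composed-lift : (x₁ : Hom T S₁.Ctx) (x₂ : Hom T S₂.Ctx) → S₁.e ∘ x₁ ≡ S₂.d ∘ x₂ →
                      Σ[ x ∈ Hom T S.Ctx ] (S.d ∘ x ≡ S₁.d ∘ x₁ × S.e ∘ x ≡ S₂.e ∘ x₂)
      composed-lift =
        Concurrency.conc-lift {T₁ = first C} {second C} C.pb-K E C.out-mono C.in-mono

    emb-factor : {S₁ : Step r₁ X} {S₂ : Step r₂ (Step.H S₁)}
                 {S₁' : Step r₁ Y} {S₂' : Step r₂ (Step.H S₁')}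
                 (E : Emb C S₁ S₂) (G : Mor2 S₁' S₂' S₁ S₂) →
                 Σ[ E' ∈ Emb C S₁' S₂' ] Mor2.f G ∘ Mor2.f E' ≡ Mor2.f E
    emb-factor E = Concurrency.factor {T₁ = first C} {second C} C.pb-K E C.po-I (Span.sl-mono μ) C.po-N

  step-over : {r : Rule 𝒞} {T : Step r A} {S : Step r X} {S' : Step r Y}
              {p : Hom A X} {p' : Hom A Y} {f : Hom X Y} →
              StepMor T S p → StepMor T S' p' → Mon f → f ∘ p ≡ p' → StepMor S S' f
  step-over {T = T} {f = f} m m' fm eq =
    mkMor fm (f ∘⟨ sym (f-b m) ∙ pull eq (Step.b T) ∙ f-b m')

  mor2-over : {r₁ r₂ : Rule 𝒞} {T₁ : Step r₁ A} {T₂ : Step r₂ (Step.H T₁)}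
              {S₁ : Step r₁ X} {S₂ : Step r₂ (Step.H S₁)} {S₁' : Step r₁ Y} {S₂' : Step r₂ (Step.H S₁')}
              (E : Mor2 T₁ T₂ S₁ S₂) (E' : Mor2 T₁ T₂ S₁' S₂') {f : Hom X Y} (m : StepMor S₁ S₁' f) →
              Mon f → f ∘ Mor2.f E ≡ Mor2.f E' → StepMor S₂ S₂' (η m)
  mor2-over E E' m fm eq = step-over (Mor2.m₂ E) (Mor2.m₂ E') (η-mono m fm)
    (η-unique (m ⊚ Mor2.m₁ E) (Mor2.m₁ E') eq)

  record Der3 (R₁ R₂ R₃ : RuleC 𝒞) (X : Obj) : Set (o ⊔ ℓ) where
    constructor mkDer3
    field
      S₁  : Step (RuleC.rl R₁) X
      S₂  : Step (RuleC.rl R₂) (Step.H S₁)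
      S₃  : Step (RuleC.rl R₃) (Step.H S₂)

  record Mor3 {R₁ R₂ R₃ : RuleC 𝒞} (t : Der3 R₁ R₂ R₃ X) (t' : Der3 R₁ R₂ R₃ Y) : Set (o ⊔ ℓ) where
    constructor mkMor3
    private
      module t  = Der3 t
      module t' = Der3 t'
    field
      f      : Hom X Y
      f-mono : Mon f
      m₁     : StepMor t.S₁ t'.S₁ f
      m₂     : StepMor t.S₂ t'.S₂ (η m₁)
      m₃     : StepMor t.S₃ t'.S₃ (η m₂)

    front : Mor2 t.S₁ t.S₂ t'.S₁ t'.S₂
    front = mkMor2 f f-mono m₁ m₂
    back : Mor2 t.S₂ t.S₃ t'.S₂ t'.S₃
    back = mkMor2 (η m₁) (η-mono m₁ f-mono) m₂ m₃

  module _ {R₁ R₂ R₃ : RuleC 𝒞} where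
    private
      r₁ = RuleC.rl R₁
      r₂ = RuleC.rl R₂
      r₃ = RuleC.rl R₃

    module _ {μ₂₁ : Span 𝒞 (InC 𝒞 R₂) (OutC 𝒞 R₁)} (C₂₁ : Comp 𝒞 R₂ R₁ μ₂₁)
             {μ₃ : Span 𝒞 (InC 𝒞 R₃) (OutC 𝒞 (compRuleC 𝒞 C₂₁))}
             (C₃ : Comp 𝒞 R₃ (compRuleC 𝒞 C₂₁) μ₃) where

      -- An occurrence of the composite rule in t; its match is the match f of E₃.
      record EmbA (t : Der3 R₁ R₂ R₃ X) : Set (o ⊔ ℓ) where
        constructor mkEmbA
        open Der3 t
        field
          E₂₁ : Emb C₂₁ S₁ S₂
          E₃  : Emb C₃ (composed C₂₁ E₂₁) S₃
        open Mor2 E₃ public using (f; f-mono)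

      -- Sesqui-pushout steps exist at every monic match, so each of the three is performed at the
      -- image of the corresponding match inside the composite.
      derA : {f : Hom (Comp.I₂₁ C₃) X} → Mon f → Σ[ t ∈ Der3 R₁ R₂ R₃ X ] Σ[ E ∈ EmbA t ] EmbA.f E ≡ f
      derA {f = f} fm = mkDer3 S₁ S₂ S₃ , mkEmbA E₂₁ (mkMor2 f fm n₁ n₂) , refl
        where
        gm : Mon (f ∘ Step.b (first C₃))
        gm = ∘-mono fm (Step.b-mono (first C₃))
        S₁ : Step r₁ _
        S₁ = mkStep ((f ∘ Step.b (first C₃)) ∘ Step.b (first C₂₁)) (∘-mono gm (Step.b-mono (first C₂₁)))
        m₁ : StepMor (first C₂₁) S₁ (f ∘ Step.b (first C₃))
        m₁ = mkMor gm refl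
        S₂ : Step r₂ (Step.H S₁)
        S₂ = mkStep (η m₁ ∘ Step.b (second C₂₁)) (∘-mono (η-mono m₁ gm) (Step.b-mono (second C₂₁)))
        m₂ : StepMor (second C₂₁) S₂ (η m₁)
        m₂ = mkMor (η-mono m₁ gm) refl
        E₂₁ : Emb C₂₁ S₁ S₂
        E₂₁ = mkMor2 (f ∘ Step.b (first C₃)) gm m₁ m₂
        n₁ : StepMor (first C₃) (composed C₂₁ E₂₁) f
        n₁ = mkMor fm refl
        S₃ : Step r₃ (Step.H S₂)
        S₃ = mkStep (η n₁ ∘ Step.b (second C₃)) (∘-mono (η-mono n₁ fm) (Step.b-mono (second C₃)))
        n₂ : StepMor (second C₃) S₃ (η n₁)
        n₂ = mkMor (η-mono n₁ fm) refl

      module _ {t : Der3 R₁ R₂ R₃ X} {t' : Der3 R₁ R₂ R₃ Y} where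
        -- All matches come from the input of the composite, so agreement there makes `f`, and then
        -- the induced maps of results, respect every match.
        morA : (F : EmbA t) (F' : EmbA t') {f : Hom X Y} → Mon f →
               f ∘ EmbA.f F ≡ EmbA.f F' → Mor3 t t'
        morA (mkEmbA E₂₁ E₃) (mkEmbA E₂₁' E₃') {f} fm eq = mkMor3 f fm m₁ m₂ m₃
          where
          eq₁ : f ∘ Mor2.f E₂₁ ≡ Mor2.f E₂₁'
          eq₁ = f ∘⟨ sym (f-b (Mor2.m₁ E₃)) ∙ pull eq _ ∙ f-b (Mor2.m₁ E₃')
          m₁ = step-over (Mor2.m₁ E₂₁) (Mor2.m₁ E₂₁') fm eq₁
          m₂ = mor2-over E₂₁ E₂₁' m₁ fm eq₁
          m₃ = mor2-over E₃ E₃' (composed-mor C₂₁ E₂₁ E₂₁' (mkMor2 f fm m₁ m₂) eq₁) fm eq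

        compA : Mor3 t t' → EmbA t → EmbA t'
        compA G (mkEmbA E₂₁ E₃) = mkEmbA (front ⊛ E₂₁)
          (mkMor2 f f-mono (composed-mor C₂₁ E₂₁ (front ⊛ E₂₁) front refl) m₃ ⊛ E₃)
          where open Mor3 G

        -- Factoring the inner composite turns the first two steps of `t'` into one step of the
        -- composed rule, to which leastness of the outer composite applies.
        factorA : (F : EmbA t) (G : Mor3 t' t) → Σ[ F' ∈ EmbA t' ] Mor3.f G ∘ EmbA.f F' ≡ EmbA.f F
        factorA (mkEmbA E₂₁ E₃) G =
          let (E₂₁' , eq)  = emb-factor C₂₁ E₂₁ front
              (E₃'  , eq') = emb-factor C₃ E₃
                (mkMor2 f f-mono (composed-mor C₂₁ E₂₁' E₂₁ front eq) m₃)
          in mkEmbA E₂₁' E₃' , eq'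
          where open Mor3 G

    module _ {μ₃₂ : Span 𝒞 (InC 𝒞 R₃) (OutC 𝒞 R₂)} (C₃₂ : Comp 𝒞 R₃ R₂ μ₃₂)
             {μ₁ : Span 𝒞 (InC 𝒞 (compRuleC 𝒞 C₃₂)) (OutC 𝒞 R₁)}
             (C₁ : Comp 𝒞 (compRuleC 𝒞 C₃₂) R₁ μ₁) where

      record EmbB (t : Der3 R₁ R₂ R₃ X) : Set (o ⊔ ℓ) where
        constructor mkEmbB
        open Der3 t
        field
          E₃₂ : Emb C₃₂ S₂ S₃
          E₁  : Emb C₁ S₁ (composed C₃₂ E₃₂)
        open Mor2 E₁ public using (f; f-mono)

      derB : {f : Hom (Comp.I₂₁ C₁) X} → Mon f → Σ[ t ∈ Der3 R₁ R₂ R₃ X ] Σ[ E ∈ EmbB t ] EmbB.f E ≡ f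
      derB {f = f} fm = mkDer3 S₁ S₂ S₃ , mkEmbB E₃₂ (mkMor2 f fm m₁ (mkMor hm refl)) , refl
        where
        S₁ : Step r₁ _
        S₁ = mkStep (f ∘ Step.b (first C₁)) (∘-mono fm (Step.b-mono (first C₁)))
        m₁ : StepMor (first C₁) S₁ f
        m₁ = mkMor fm refl
        hm : Mon (η m₁)
        hm = η-mono m₁ fm
        gm : Mon (η m₁ ∘ Step.b (second C₁))
        gm = ∘-mono hm (Step.b-mono (second C₁))
        S₂ : Step r₂ (Step.H S₁)
        S₂ = mkStep ((η m₁ ∘ Step.b (second C₁)) ∘ Step.b (first C₃₂)) (∘-mono gm (Step.b-mono (first C₃₂)))
        n₁ : StepMor (first C₃₂) S₂ (η m₁ ∘ Step.b (second C₁))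
        n₁ = mkMor gm refl
        S₃ : Step r₃ (Step.H S₂)
        S₃ = mkStep (η n₁ ∘ Step.b (second C₃₂)) (∘-mono (η-mono n₁ gm) (Step.b-mono (second C₃₂)))
        E₃₂ : Emb C₃₂ S₂ S₃
        E₃₂ = mkMor2 (η m₁ ∘ Step.b (second C₁)) gm n₁ (mkMor (η-mono n₁ gm) refl)

      module _ {t : Der3 R₁ R₂ R₃ X} {t' : Der3 R₁ R₂ R₃ Y} where
        morB : (F : EmbB t) (F' : EmbB t') {f : Hom X Y} → Mon f →
               f ∘ EmbB.f F ≡ EmbB.f F' → Mor3 t t'
        morB (mkEmbB E₃₂ E₁) (mkEmbB E₃₂' E₁') {f} fm eq = mkMor3 f fm m₁ m₂ m₃
          where
          m₁ = step-over (Mor2.m₁ E₁) (Mor2.m₁ E₁') fm eq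
          eq₂ : η m₁ ∘ Mor2.f E₃₂ ≡ Mor2.f E₃₂'
          eq₂ = η m₁ ∘⟨ sym (f-b (Mor2.m₂ E₁))
                ∙ pull (η-unique (m₁ ⊚ Mor2.m₁ E₁) (Mor2.m₁ E₁') eq) _ ∙ f-b (Mor2.m₂ E₁')
          m₂ = step-over (Mor2.m₁ E₃₂) (Mor2.m₁ E₃₂') (η-mono m₁ fm) eq₂
          m₃ = mor2-over E₃₂ E₃₂' m₂ (η-mono m₁ fm) eq₂

        compB : Mor3 t t' → EmbB t → EmbB t'
        compB G (mkEmbB E₃₂ E₁) = mkEmbB (back ⊛ E₃₂)
          (mkMor2 f f-mono m₁ (composed-mor C₃₂ E₃₂ (back ⊛ E₃₂) back refl) ⊛ E₁)
          where open Mor3 G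

-- Similarity of match pairs occurring in a common derivation.

module MatchIsomorphisms {o ℓ : Level} (𝒞 : Category o ℓ) (𝒜 : SqPOAdhesive 𝒞) where
  open Category 𝒞
  open SqPOAdhesive 𝒜
  open SqPORewriting 𝒞 𝒜
  open Derivations 𝒞 𝒜

  private variable
    A B E P Q X Y Z A' B' : Obj

  iso-mono : {f : Hom A B} → Iso 𝒞 f → Mon f
  iso-mono (g , gf , _) x y e = sym (cancel gf x) ∙ g ∘⟨ e ∙ cancel gf y

  id-iso : Iso 𝒞 (id {A})
  id-iso = id , identityˡ , identityˡ

  module _ {r : Rule 𝒞} {S : Step r X} {S' : Step r Y} {f : Hom X Y} {g : Hom Y X}
           (m : StepMor S S' f) (n : StepMor S' S g) (gf : g ∘ f ≡ id) (fg : f ∘ g ≡ id) where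
    δ-iso : Iso 𝒞 (δ m)
    δ-iso = δ n , δ-unique (n ⊚ m) idMor gf , δ-unique (m ⊚ n) idMor fg

    η-iso : Iso 𝒞 (η m)
    η-iso = η n , η-unique (n ⊚ m) idMor gf , η-unique (m ⊚ n) idMor fg

  pb-map : {f : Hom P A} {g : Hom P B} {m : Hom A E} {n : Hom B E}
           {f' : Hom Q A'} {g' : Hom Q B'} {m' : Hom A' X} {n' : Hom B' X}
           {h : Hom E Y} {h' : Hom X Y} {s : Hom A A'} {t : Hom B B'} →
           PB f g m n → PB f' g' m' n' → Mon h' →
           h' ∘ m' ∘ s ≡ h ∘ m → h' ∘ n' ∘ t ≡ h ∘ n →
           Σ[ φ ∈ Hom P Q ] (f' ∘ φ ≡ s ∘ f × g' ∘ φ ≡ t ∘ g)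
  pb-map {m' = m'} {n'} {h} {h'} pb pb' hm p q = PB.universal pb' _ _
    (hm _ _ (h' ∘⟨ sym assoc ∙ pull p _ ∙ assoc ∙ h ∘⟨ PB.commute pb
             ∙ sym (h' ∘⟨ sym assoc ∙ pull q _ ∙ assoc)))

  module _ {N' H A A' B B' : Obj} where
    -- Since `h` and `h'` are monic, each apex is the intersection of its two legs inside `H`; up to
    -- `s` and `t` these are the same subobjects.
    span-iso : {N : Obj} {μ : Span 𝒞 A B} {μ' : Span 𝒞 A' B'} {m : Hom A N} {n : Hom B N}
               {m' : Hom A' N'} {n' : Hom B' N'} {h : Hom N H} {h' : Hom N' H}
               {s : Hom A A'} {t : Hom B B'} →
               PB (Span.sl μ) (Span.sr μ) m n → PB (Span.sl μ') (Span.sr μ') m' n' →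
               Mon h → Mon h' → Iso 𝒞 s → Iso 𝒞 t →
               h' ∘ m' ∘ s ≡ h ∘ m → h' ∘ n' ∘ t ≡ h ∘ n → SpanIsoOver 𝒞 s t μ μ'
    span-iso {_} {μ} {μ'} {m} {n} {m'} {n'} {h} {h'} {s} {t}
             pb pb' hm hm' (s⁻ , s⁻s , ss⁻) (t⁻ , _ , tt⁻) p q = record
      { φ = φ ; φ-l = φl ; φ-r = φr
      ; φ-iso = ψ , Span.sl-mono μ _ _ (pull ψl φ ∙ assoc ∙ s⁻ ∘⟨ φl ∙ cancel s⁻s _ ∙ sym identityʳ)
                  , Span.sl-mono μ' _ _ (pull φl ψ ∙ assoc ∙ s ∘⟨ ψl ∙ cancel ss⁻ _ ∙ sym identityʳ) }
      where
      there = pb-map pb pb' hm' p q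
      back' = pb-map pb' pb hm
        (pull (sym p) s⁻ ∙ assoc ∙ h' ∘⟨ (assoc ∙ m' ∘⟨ ss⁻ ∙ identityʳ))
        (pull (sym q) t⁻ ∙ assoc ∙ h' ∘⟨ (assoc ∙ n' ∘⟨ tt⁻ ∙ identityʳ))
      φ  = proj₁ there
      φl = proj₁ (proj₂ there)
      φr = proj₂ (proj₂ there)
      ψ  = proj₁ back'
      ψl = proj₁ (proj₂ back')

    span-pb : {μ : Span 𝒞 A B} {μ' : Span 𝒞 A' B'} {m' : Hom A' N'} {n' : Hom B' N'} {h' : Hom N' H}
              {s : Hom A A'} {t : Hom B B'} {u : Hom A H} {v : Hom B H} →
              SpanIsoOver 𝒞 s t μ μ' → PB (Span.sl μ') (Span.sr μ') m' n' →
              Mon h' → Mon s → Mon v → h' ∘ m' ∘ s ≡ u → h' ∘ n' ∘ t ≡ v →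
              PB (Span.sl μ) (Span.sr μ) u v
    span-pb {μ} {μ'} {m'} {n'} {h'} {s} {t} {u} {v} σ pb' hm sm vm p q =
      mkPB (sym p ⟩∘ _ ∙ side s φ-l ∙ h' ∘⟨ push (PB.commute pb') φ
              ∙ sym (sym q ⟩∘ _ ∙ side t φ-r))
        (Span.sl-mono μ) vm
        λ x y e →
          let (w , lw , _) = PB.universal pb' (s ∘ x) (t ∘ y)
                (hm _ _ (h' ∘⟨ sym assoc ∙ pull p x ∙ e ∙ sym (h' ∘⟨ sym assoc ∙ pull q y)))
          in ψ ∘ w , sm _ _ (push (sym φ-l) _ ∙ Span.sl μ' ∘⟨ cancel φψ w ∙ lw)
      where
      open SpanIsoOver σ
      ψ = proj₁ φ-iso
      φψ : φ ∘ ψ ≡ id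
      φψ = proj₂ (proj₂ φ-iso)
      side : {m : Hom Y N'} {l : Hom (Span.apex μ') Y} {k : Hom (Span.apex μ) Z} →
             (g' : Hom Z Y) → l ∘ φ ≡ g' ∘ k → (h' ∘ m ∘ g') ∘ k ≡ h' ∘ m ∘ l ∘ φ
      side g' e = assoc ∙ h' ∘⟨ (assoc ∙ _ ∘⟨ sym e)

  module _ {R₁ R₂ R₁' R₂' : RuleC 𝒞}
           {μ : Span 𝒞 (InC 𝒞 R₂) (OutC 𝒞 R₁)} (C : Comp 𝒞 R₂ R₁ μ)
           {μ' : Span 𝒞 (InC 𝒞 R₂') (OutC 𝒞 R₁')} (C' : Comp 𝒞 R₂' R₁' μ')
           {s : Hom (InC 𝒞 R₂) (InC 𝒞 R₂')} {t : Hom (OutC 𝒞 R₁) (OutC 𝒞 R₁')} where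
    -- Spans isomorphic over `s` and `t` have the same intersection in the middle object, so the
    -- pushout of `μ` is the union there and effective unions embed it.
    emb-via : SpanIsoOver 𝒞 s t μ μ' → Mon s →
              (S₁ : Step (RuleC.rl R₁) X) (S₂ : Step (RuleC.rl R₂) (Step.H S₁))
              (h' : Hom (Comp.N C') (Step.H S₁)) → Mon h' →
              h' ∘ Comp.m₂' C' ∘ s ≡ Step.b S₂ → h' ∘ Comp.m₁' C' ∘ t ≡ Step.a S₁ → Emb C S₁ S₂
    emb-via σ sm S₁ S₂ h' hm p q =
      let pb = span-pb σ (po-pb (Comp.po-N C') (Span.sl-mono μ')) hm sm (Step.a-mono S₁) p q
          (h , h₂ , h₁) = PO.universal (Comp.po-N C) (Step.b S₂) (Step.a S₁) (PB.commute pb)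
      in emb C S₁ S₂ h
           (union-mono pb (Step.b-mono S₂) (Step.a-mono S₁) (Comp.po-N C) h h₂ h₁) h₁ h₂

  comp-pb : {R₂ R₁ : RuleC 𝒞} {μ : Span 𝒞 (InC 𝒞 R₂) (OutC 𝒞 R₁)} (C : Comp 𝒞 R₂ R₁ μ) →
            PB (Span.sl μ) (Span.sr μ) (Comp.m₂' C) (Comp.m₁' C)
  comp-pb {μ = μ} C = po-pb (Comp.po-N C) (Span.sl-mono μ)

  module _ {R₁ R₂ R₃ : RuleC 𝒞} where
    module _ {a a' : MA 𝒞 R₁ R₂ R₃} {t : Der3 R₁ R₂ R₃ X} where
      private
        module a  = MA a
        module a' = MA a'

      -- Inside `t` each inner composite factors through the other by leastness, and the
      -- factorizations are inverse because both embed into `X`. The comparison maps are components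
      -- of the resulting step morphisms.
      simA : EmbA a.C₂₁ a.C₃ t → EmbA a'.C₂₁ a'.C₃ t → SimA 𝒞 a a'
      simA (mkEmbA E E₃) (mkEmbA E' E₃') = record
        { iso₂₁ = span-iso (comp-pb a.C₂₁) (comp-pb a'.C₂₁) h-mono h'-mono id-iso id-iso
                    (h' ∘⟨ identityʳ ∙ f-b E'.m₂ ∙ sym (f-b E.m₂))
                    (h' ∘⟨ identityʳ ∙ η-a E'.m₁ ∙ sym (η-a E.m₁))
        ; ν = η F.m₁ ; ν-iso = η-iso F.m₁ F'.m₁ F'F FF'
        ; ν-2 = f-b F.m₂ ; ν-1 = η-a F.m₁
        ; κ = δ F.m₂ ; κ-iso = δ-iso F.m₂ F'.m₂ νν νν'
        ; κ-k = δ-k F.m₂ ; κ-n = d-δ F.m₂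
        ; θ = η F.m₂ ; θ-iso = η-iso F.m₂ F'.m₂ νν νν'
        ; θ-j = η-a F.m₂ ; θ-K = η-e F.m₂
        ; iso₃ = span-iso (comp-pb a.C₃) (comp-pb a'.C₃)
                   (η-mono (Mor2.m₁ E₃) (Mor2.f-mono E₃)) (η-mono (Mor2.m₁ E₃') (Mor2.f-mono E₃'))
                   id-iso (η-iso F.m₂ F'.m₂ νν νν')
                   (_ ∘⟨ identityʳ ∙ f-b (Mor2.m₂ E₃') ∙ sym (f-b (Mor2.m₂ E₃)))
                   (pull (η-a (Mor2.m₁ E₃')) _
                    ∙ η-unique (E'.m₂ ⊚ F.m₂) E.m₂ (η-unique (E'.m₁ ⊚ F.m₁) E.m₁ eF)
                    ∙ sym (η-a (Mor2.m₁ E₃))) }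
        where
        module E  = Mor2 E
        module E' = Mor2 E'
        h' = η E'.m₁
        h-mono : Mon (η E.m₁)
        h-mono = η-mono E.m₁ E.f-mono
        h'-mono : Mon (η E'.m₁)
        h'-mono = η-mono E'.m₁ E'.f-mono
        module F  = Mor2 (proj₁ (emb-factor a.C₂₁ E E'))
        module F' = Mor2 (proj₁ (emb-factor a'.C₂₁ E' E))
        eF : E'.f ∘ F.f ≡ E.f
        eF = proj₂ (emb-factor a.C₂₁ E E')
        eF' : E.f ∘ F'.f ≡ E'.f
        eF' = proj₂ (emb-factor a'.C₂₁ E' E)
        F'F : F'.f ∘ F.f ≡ id
        F'F = E.f-mono _ _ (pull eF' F.f ∙ eF ∙ sym identityʳ)
        FF' : F.f ∘ F'.f ≡ id
        FF' = E'.f-mono _ _ (pull eF F'.f ∙ eF' ∙ sym identityʳ)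
        νν : η F'.m₁ ∘ η F.m₁ ≡ id
        νν = η-unique (F'.m₁ ⊚ F.m₁) idMor F'F
        νν' : η F.m₁ ∘ η F'.m₁ ≡ id
        νν' = η-unique (F.m₁ ⊚ F'.m₁) idMor FF'

      simA-emb : SimA 𝒞 a a' → EmbA a'.C₂₁ a'.C₃ t → EmbA a.C₂₁ a.C₃ t
      simA-emb σ (mkEmbA E E₃) = mkEmbA (E ⊛ F)
        (emb-via a.C₃ a'.C₃ iso₃ id-mono _ _ (η (Mor2.m₁ E₃)) (η-mono (Mor2.m₁ E₃) (Mor2.f-mono E₃))
          (_ ∘⟨ identityʳ ∙ f-b (Mor2.m₂ E₃))
          (pull (η-a (Mor2.m₁ E₃)) θ ∙ η (Mor2.m₂ E) ∘⟨ sym Fθ))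
        where
        open SimA σ
        F = emb a.C₂₁ (first a'.C₂₁) (second a'.C₂₁) ν (iso-mono ν-iso) ν-1 ν-2
        -- The data of the similarity form a step morphism over `ν`. Such a morphism is determined
        -- by the map it lies over, so the induced map of results is the given `θ`.
        Fθ : η (Mor2.m₂ F) ≡ θ
        Fθ = η-unique (Mor2.m₂ F) θ-mor
               (emb-η a.C₂₁ (first a'.C₂₁) (second a'.C₂₁) ν (iso-mono ν-iso) ν-1 ν-2)
          where
          θ-mor : StepMor (second a.C₂₁) (second a'.C₂₁) ν
          θ-mor = record { δ = κ ; η = θ ; f-b = ν-2 ; d-δ = κ-n ; η-a = θ-j ; η-e = θ-K }

    module _ {b b' : MB 𝒞 R₁ R₂ R₃} {t : Der3 R₁ R₂ R₃ X} where
      private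
        module b  = MB b
        module b' = MB b'

      simB : EmbB b.C₃₂ b.C₁ t → EmbB b'.C₃₂ b'.C₁ t → SimB 𝒞 b b'
      simB (mkEmbB E E₁) (mkEmbB E' E₁') = record
        { iso₃₂ = span-iso (comp-pb b.C₃₂) (comp-pb b'.C₃₂) h-mono h'-mono id-iso id-iso
                    (h' ∘⟨ identityʳ ∙ f-b E'.m₂ ∙ sym (f-b E.m₂))
                    (h' ∘⟨ identityʳ ∙ η-a E'.m₁ ∙ sym (η-a E.m₁))
        ; ν = η F.m₁ ; ν-iso = η-iso F.m₁ F'.m₁ F'F FF'
        ; ν-2 = f-b F.m₂ ; ν-1 = η-a F.m₁
        ; κ = δ F.m₁ ; κ-iso = δ-iso F.m₁ F'.m₁ F'F FF'
        ; κ-k = δ-k F.m₁ ; κ-n = sym (η-e F.m₁)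
        ; θ = F.f ; θ-iso = F'.f , F'F , FF'
        ; θ-p = f-b F.m₁ ; θ-q = sym (d-δ F.m₁)
        ; iso₁ = span-iso (comp-pb b.C₁) (comp-pb b'.C₁)
                   (η-mono (Mor2.m₁ E₁) (Mor2.f-mono E₁)) (η-mono (Mor2.m₁ E₁') (Mor2.f-mono E₁'))
                   (F'.f , F'F , FF') id-iso
                   (pull (f-b (Mor2.m₂ E₁')) F.f ∙ eF ∙ sym (f-b (Mor2.m₂ E₁)))
                   (_ ∘⟨ identityʳ ∙ η-a (Mor2.m₁ E₁') ∙ sym (η-a (Mor2.m₁ E₁))) }
        where
        module E  = Mor2 E
        module E' = Mor2 E'
        h' = η E'.m₁
        h-mono : Mon (η E.m₁)
        h-mono = η-mono E.m₁ E.f-mono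
        h'-mono : Mon (η E'.m₁)
        h'-mono = η-mono E'.m₁ E'.f-mono
        module F  = Mor2 (proj₁ (emb-factor b.C₃₂ E E'))
        module F' = Mor2 (proj₁ (emb-factor b'.C₃₂ E' E))
        eF : E'.f ∘ F.f ≡ E.f
        eF = proj₂ (emb-factor b.C₃₂ E E')
        eF' : E.f ∘ F'.f ≡ E'.f
        eF' = proj₂ (emb-factor b'.C₃₂ E' E)
        F'F : F'.f ∘ F.f ≡ id
        F'F = E.f-mono _ _ (pull eF' F.f ∙ eF ∙ sym identityʳ)
        FF' : F.f ∘ F'.f ≡ id
        FF' = E'.f-mono _ _ (pull eF F'.f ∙ eF' ∙ sym identityʳ)

      simB-emb : SimB 𝒞 b b' → EmbB b'.C₃₂ b'.C₁ t → EmbB b.C₃₂ b.C₁ t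
      simB-emb σ (mkEmbB E E₁) = mkEmbB (E ⊛ F)
        (emb-via b.C₁ b'.C₁ iso₁ (iso-mono θ-iso) _ _
          (η (Mor2.m₁ E₁)) (η-mono (Mor2.m₁ E₁) (Mor2.f-mono E₁))
          (pull (f-b (Mor2.m₂ E₁)) θ)
          (_ ∘⟨ identityʳ ∙ η-a (Mor2.m₁ E₁)))
        where
        open SimB σ
        F : Emb b.C₃₂ (first b'.C₃₂) (second b'.C₃₂)
        F = mkMor2 θ (iso-mono θ-iso)
          (record { δ = κ ; η = ν ; f-b = θ-p ; d-δ = sym θ-q ; η-a = ν-1 ; η-e = sym κ-n })
          (mkMor (iso-mono ν-iso) ν-2)

-- Satisfaction of shifted, transported and composite conditions.

module ApplicationConditions {o ℓ : Level} (𝒞 : Category o ℓ) (𝒜 : SqPOAdhesive 𝒞) where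
  open Category 𝒞
  open SqPOAdhesive 𝒜
  open SqPORewriting 𝒞 𝒜
  open Derivations 𝒞 𝒜
  open MatchIsomorphisms 𝒞 𝒜

  private variable
    P Q X Y : Obj

  infix 2 _⟷_
  _⟷_ : ∀ {a b} → Set a → Set b → Set (a ⊔ b)
  S ⟷ T = (S → T) × (T → S)

  ⟷-trans : ∀ {a b c} {S : Set a} {T : Set b} {U : Set c} → S ⟷ T → T ⟷ U → S ⟷ U
  ⟷-trans (f , g) (h , k) = (λ s → h (f s)) , (λ u → g (k u))

  ×-⟷ : ∀ {a b c d} {S : Set a} {T : Set b} {U : Set c} {V : Set d} →
        S ⟷ T → U ⟷ V → (S × U) ⟷ (T × V)
  ×-⟷ (f , g) (h , k) = (λ (s , u) → f s , h u) , (λ (t , v) → g t , k v)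

  -- The negative translation of satisfaction.  Shift and Trans turn an existential into a
  -- disjunction, encoded as a negated conjunction, and so preserve satisfaction only up to ¬¬.
  NSat : Hom P X → Cond 𝒞 P → Set (o ⊔ ℓ)
  NSat p cTrue = Sat 𝒞 p cTrue
  NSat {X = X} p (cEx {Q = Q} a _ c) = ¬ ¬ (Σ[ q ∈ Hom Q X ] (Mon q × q ∘ a ≡ p × NSat q c))
  NSat p (cNot c) = ¬ NSat p c
  NSat p (cAnd I f) = ∀ i → NSat p (f i)

  nsat-resp : (c : Cond 𝒞 P) {p q : Hom P X} → p ≡ q → NSat p c ⟷ NSat q c
  nsat-resp c refl = (λ s → s) , (λ s → s)

  ¬-⟷ : ∀ {a b} {S : Set a} {T : Set b} → S ⟷ T → ¬ S ⟷ ¬ T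
  ¬-⟷ (f , g) = (λ n t → n (g t)) , (λ n s → n (f s))

  -- On these conditions the translation changes nothing. `Shift` and `Trans` produce only such
  -- conditions, so nested composites unfold exactly.
  Negative : Cond 𝒞 P → Set (o ⊔ ℓ)
  Negative {P} c = ∀ {X} (q : Hom P X) → NSat q c ⟷ Sat 𝒞 q c

  or-negative : {I : Set (o ⊔ ℓ)} {Q : I → Obj} {a : ∀ i → Hom P (Q i)} {am : ∀ i → Mon (a i)}
                {c : ∀ i → Cond 𝒞 (Q i)} → (∀ i → Negative (c i)) →
                Negative (cOr 𝒞 I (λ i → cEx (a i) (am i) (c i)))
  or-negative neg q =
    (λ n k → n λ i nn → nn λ (q' , q'm , e , s) → k i (q' , q'm , e , proj₁ (neg i q') s)) ,
    (λ n k → n λ i (q' , q'm , e , s) → k i λ l → l (q' , q'm , e , proj₂ (neg i q') s))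

  shift-negative : (p : Hom P Q) (c : Cond 𝒞 P) → Negative (Shift 𝒞 p c)
  shift-negative p cTrue q = (λ s → s) , (λ s → s)
  shift-negative p (cEx a _ c) =
    or-negative {am = λ t → ShiftIdx.r-mono t} (λ t → shift-negative (ShiftIdx.s t) c)
  shift-negative p (cNot c) q = ¬-⟷ (shift-negative p c q)
  shift-negative p (cAnd I f) q =
    (λ s i → proj₁ (shift-negative p (f i) q) (s i)) , (λ s i → proj₂ (shift-negative p (f i) q) (s i))

  trans-negative : {K O I : Obj} (l : Hom K O) (i : Hom K I) (c : Cond 𝒞 O) → Negative (Trans 𝒞 l i c)
  trans-negative l i cTrue q = (λ s → s) , (λ s → s)
  trans-negative l i (cEx a _ c) =
    or-negative {am = λ t → TransIdx.a*-mono t}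
      (λ t → trans-negative (TransIdx.o' t) (TransIdx.i' t) c)
  trans-negative l i (cNot c) q = ¬-⟷ (trans-negative l i c q)
  trans-negative l i (cAnd J f) q =
    (λ s j → proj₁ (trans-negative l i (f j) q) (s j)) ,
    (λ s j → proj₂ (trans-negative l i (f j) q) (s j))

  and-negative : {c d : Cond 𝒞 P} → Negative c → Negative d → Negative (_∧c_ 𝒞 c d)
  and-negative nc nd q =
    (λ { s (lift true) → proj₁ (nc q) (s (lift true))
       ; s (lift false) → proj₁ (nd q) (s (lift false)) }) ,
    (λ { s (lift true) → proj₂ (nc q) (s (lift true))
       ; s (lift false) → proj₂ (nd q) (s (lift false)) })

  and-sat : (c d : Cond 𝒞 P) (q : Hom P X) → Sat 𝒞 q (_∧c_ 𝒞 c d) ⟷ (Sat 𝒞 q c × Sat 𝒞 q d)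
  and-sat _ _ q = (λ s → s (lift true) , s (lift false)) ,
              (λ { (s , _) (lift true) → s ; (_ , s) (lift false) → s })

  -- The indices list the ways in which the targets of `p` and `a` can overlap. For a given
  -- extension `q'`, the right one is the intersection of `q` and `q'`, whose pushout embeds as
  -- their union.
  shift-sat : {p : Hom P Q} {q : Hom Q X} → Mon p → Mon q → (c : Cond 𝒞 P) →
              Sat 𝒞 q (Shift 𝒞 p c) ⟷ NSat (q ∘ p) c
  shift-sat pm qm cTrue = (λ s → s) , (λ s → s)
  shift-sat {p = p} {q} pm qm (cEx a am c) =
    (λ n k → n λ t (q' , q'm , e , s) →
      let open ShiftIdx t renaming (s to s')
          sm = mono-pushout-stable po p''-mono
      in k (q' ∘ s' , ∘-mono q'm sm
           , (assoc ∙ q' ∘⟨ (s' ∘⟨ sym a''x ∙ push (sym (PO.commute po)) x) ∙ pull e _ ∙ q ∘⟨ p''x)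
           , proj₁ (shift-sat sm q'm c) s)) ,
    (λ n k → n λ (q' , q'm , e , s) →
      let (A , p'' , a'' , pb)  = pullbacks q q'
          p''m                  = mono-pullback-stable pb q'm
          a''m                  = mono-pullback-stable (pb-sym pb) qm
          (x , p''x , a''x)     = PB.universal pb p a (sym e)
          (E , r , s' , po)     = pushouts-along-mono p'' a'' p''m
          (u , ur , us)         = PO.universal po q q' (PB.commute pb)
          um                    = union-mono pb qm q'm po u ur us
      in k (record { p''-mono = p''m ; a''-mono = a''m ; x-mono = mono-cancel pm p''x
                   ; p''x = p''x ; a''x = a''x ; po = po
                   ; r-mono = mono-pushout-stable (po-sym po) a''m })
           (u , um , ur , proj₂ (shift-sat (mono-pushout-stable po p''m) um c)
                                (proj₂ (nsat-resp c us) s)))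
  shift-sat pm qm (cNot c) = ¬-⟷ (shift-sat pm qm c)
  shift-sat pm qm (cAnd I f) =
    (λ s i → proj₁ (shift-sat pm qm (f i)) (s i)) , (λ s i → proj₂ (shift-sat pm qm (f i)) (s i))

  module _ {r : Rule 𝒞} {T : Step r Y} {S : Step r X} {f : Hom Y X} where
    private
      module T = Step T
      module S = Step S

    -- The smaller step `T` is itself a rule, and `S` applies it at `f`. This feeds the recursion of
    -- `Trans`, which continues with the enlarged rule.
    step-along : StepMor T S f → Mon f → Step (mkRule T.H T.Ctx Y T.e T.d T.e-mono T.d-mono) X
    step-along m fm = record
      { b = f ; b-mono = fm ; k = δ m ; d = S.d ; d-mono = S.d-mono ; sq = sym (d-δ m)
      ; meet  = restrict m
      ; final = λ z avoid → S.final z λ x y e →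
          let (w , p) = avoid (T.b ∘ x) y (pull (f-b m) x ∙ e) in T.meet x w (sym p)
      ; H = S.H ; a = η m ; e = S.e ; po = η-po m }

  -- An extension of the output inside the result of `S` restricts `S` to a double-pushout step,
  -- which yields the pushout complement that `Trans` asks for; `step-reflect` moves the extension
  -- to the source. Without a pushout complement there is thus no extension, matching the empty
  -- disjunction.
  trans-sat : {r : Rule 𝒞} (S : Step r X) (c : Cond 𝒞 (R.Out r)) →
              Sat 𝒞 (Step.b S) (Trans 𝒞 (R.outL r) (R.inL r) c) ⟷ NSat (Step.a S) c
  trans-sat S cTrue = (λ s → s) , (λ s → s)
  trans-sat {r = r} S (cEx a₀ am c) =
    (λ n κ → n λ t (q , qm , e , s) →
      let open TransIdx t
          T = dpoStep {r = r} poc (po-sym po)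
                (mono-cancel (∘-mono am (R.outL-mono r)) (sym (PO.commute poc)))
          m = mkMor {S = T} {S} qm e
      in κ (η m , η-mono m qm , η-a m , proj₁ (trans-sat (step-along m qm) c) s)) ,
    (λ n κ → n λ (q , qm , e , s) →
      let open DPORestriction (dpo-restrict S a₀ q qm e) using (poc; po; k-mono)
          (p' , pm , m , ηq) = step-reflect (dpoStep {r = r} poc po k-mono) S po q qm e
      in κ (record { poc = poc ; po = po-sym po ; a*-mono = mono-pushout-stable po k-mono })
           (p' , pm , f-b m , proj₂ (trans-sat (step-along m pm) c) (proj₂ (nsat-resp c ηq) s)))
  trans-sat S (cNot c) = ¬-⟷ (trans-sat S c)
  trans-sat S (cAnd J f) =
    (λ s j → proj₁ (trans-sat S (f j)) (s j)) , (λ s j → proj₂ (trans-sat S (f j)) (s j))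

  module _ {R₂ R₁ : RuleC 𝒞} {μ : Span 𝒞 (InC 𝒞 R₂) (OutC 𝒞 R₁)} (C : Comp 𝒞 R₂ R₁ μ) where
    open Comp C
    private
      c₁ = RuleC.cond R₁
      c₂ = RuleC.cond R₂

    comp-negative : Negative (compCond 𝒞 C)
    comp-negative = and-negative (shift-negative p₁ c₁) (trans-negative n₁ q₁ (Shift 𝒞 m₂' c₂))

    comp-sat : {S₁ : Step (RuleC.rl R₁) X} {S₂ : Step (RuleC.rl R₂) (Step.H S₁)} (E : Emb C S₁ S₂) →
               Sat 𝒞 (Mor2.f E) (compCond 𝒞 C) ⟷ (NSat (Step.b S₁) c₁ × NSat (Step.b S₂) c₂)
    comp-sat (mkMor2 f fm m₁ m₂) = ⟷-trans (and-sat _ _ f) (×-⟷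
      (⟷-trans (shift-sat (Step.b-mono (first C)) fm c₁) (nsat-resp c₁ (f-b m₁)))
      (⟷-trans (trans-sat (step-along m₁ fm) (Shift 𝒞 m₂' c₂))
        (⟷-trans (shift-negative m₂' c₂ (η m₁))
          (⟷-trans (shift-sat (Step.b-mono (second C)) (η-mono m₁ fm) c₂) (nsat-resp c₂ (f-b m₂))))))

  -- `Admissible` is a negation and yields no satisfying match to transport, so admissibility is
  -- transferred by contraposition.
  refute : (c : Cond 𝒞 P) → (∀ {X} {p : Hom P X} → Mon p → ¬ Sat 𝒞 p c) → _≈c_ 𝒞 c (cFalse 𝒞)
  refute _ no p pm = (λ s → contradiction s (no pm)) , (λ n → contradiction tt n)

  unsat : (c : Cond 𝒞 P) → _≈c_ 𝒞 c (cFalse 𝒞) → {p : Hom P X} → Mon p → ¬ Sat 𝒞 p c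
  unsat _ c≈ pm s = proj₁ (c≈ _ pm) s tt

  module _ {R₁ R₂ R₃ : RuleC 𝒞} where
    Sat3 : Der3 R₁ R₂ R₃ X → Set (o ⊔ ℓ)
    Sat3 t = NSat (Step.b S₁) (RuleC.cond R₁)
           × NSat (Step.b S₂) (RuleC.cond R₂)
           × NSat (Step.b S₃) (RuleC.cond R₃)
      where open Der3 t

    module _ {μ₂₁ : Span 𝒞 (InC 𝒞 R₂) (OutC 𝒞 R₁)} (C₂₁ : Comp 𝒞 R₂ R₁ μ₂₁)
             {μ₃ : Span 𝒞 (InC 𝒞 R₃) (OutC 𝒞 (compRuleC 𝒞 C₂₁))}
             (C₃ : Comp 𝒞 R₃ (compRuleC 𝒞 C₂₁) μ₃)
             {μ₃₂ : Span 𝒞 (InC 𝒞 R₃) (OutC 𝒞 R₂)} (C₃₂ : Comp 𝒞 R₃ R₂ μ₃₂)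
             {μ₁ : Span 𝒞 (InC 𝒞 (compRuleC 𝒞 C₃₂)) (OutC 𝒞 R₁)}
             (C₁ : Comp 𝒞 (compRuleC 𝒞 C₃₂) R₁ μ₁) where

      module _ {t : Der3 R₁ R₂ R₃ X} where
        open Der3 t

        satA : (E : EmbA C₂₁ C₃ t) → Sat 𝒞 (EmbA.f E) (compCond 𝒞 C₃) ⟷ Sat3 t
        satA (mkEmbA E₂₁ E₃) = ⟷-trans (comp-sat C₃ E₃) (⟷-trans
          -- The inner condition enters through `NSat`; `comp-negative` returns it to `Sat`, so that
          -- `comp-sat` applies a second time.
          (×-⟷ (⟷-trans (comp-negative C₂₁ _) (comp-sat C₂₁ E₂₁)) ((λ s → s) , (λ s → s)))
          ((λ ((x , y) , z) → x , y , z) , (λ (x , y , z) → (x , y) , z)))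

        satB : (E : EmbB C₃₂ C₁ t) → Sat 𝒞 (EmbB.f E) (compCond 𝒞 C₁) ⟷ Sat3 t
        satB (mkEmbB E₃₂ E₁) = ⟷-trans (comp-sat C₁ E₁)
          (×-⟷ ((λ s → s) , (λ s → s)) (⟷-trans (comp-negative C₃₂ _) (comp-sat C₃₂ E₃₂)))

      module _ {t : Der3 R₁ R₂ R₃ (Comp.I₂₁ C₃)} (EA : EmbA C₂₁ C₃ t) (i : EmbA.f EA ≡ id)
               (EB : EmbB C₃₂ C₁ t) where
        private
          transfer-B : {t' : Der3 R₁ R₂ R₃ Y} (EA' : EmbA C₂₁ C₃ t') → EmbB C₃₂ C₁ t'
          transfer-B EA' = compB C₃₂ C₁
            (morA C₂₁ C₃ EA EA' (EmbA.f-mono EA') (_ ∘⟨ i ∙ identityʳ)) EB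

          Over : Hom (Comp.I₂₁ C₃) X → Set (o ⊔ ℓ)
          Over {X} p = Σ[ t' ∈ Der3 R₁ R₂ R₃ X ] Σ[ EA' ∈ EmbA C₂₁ C₃ t' ] EmbA.f EA' ≡ p

          sat-over : {p : Hom (Comp.I₂₁ C₃) X} → Over p →
                     Sat 𝒞 p (compCond 𝒞 C₃) ⟷ Sat 𝒞 (p ∘ EmbB.f EB) (compCond 𝒞 C₁)
          sat-over (t' , EA' , refl) =
            let satB' = satB (transfer-B EA') in ⟷-trans (satA EA') (proj₂ satB' , proj₁ satB')

        -- The derivation performed at `p` also contains the other composite, at `p ∘ EmbB.f EB`,
        -- carried over from `t`. Both conditions amount to `Sat3` of that derivation.
        sat-A⇒B : {p : Hom (Comp.I₂₁ C₃) X} → Mon p →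
                  Sat 𝒞 p (compCond 𝒞 C₃) ⟷ Sat 𝒞 (p ∘ EmbB.f EB) (compCond 𝒞 C₁)
        sat-A⇒B pm = sat-over (derA C₂₁ C₃ pm)

        admissible-B : Admissible 𝒞 C₃ → Admissible 𝒞 C₁
        admissible-B adm c≈ = adm (refute (compCond 𝒞 C₃) λ pm s →
          unsat (compCond 𝒞 C₁) c≈ (∘-mono pm (EmbB.f-mono EB)) (proj₁ (sat-A⇒B pm) s))

        admissible-B₃₂ : Admissible 𝒞 C₃ → Admissible 𝒞 C₃₂
        admissible-B₃₂ adm c≈ = adm (refute (compCond 𝒞 C₃) λ pm → no (derA C₂₁ C₃ pm))
          where
          no : {p : Hom (Comp.I₂₁ C₃) X} → Over p → ¬ Sat 𝒞 p (compCond 𝒞 C₃)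
          no (t' , EA' , refl) s =
            let E = EmbB.E₃₂ (transfer-B EA')
            in unsat (compCond 𝒞 C₃₂) c≈ (Mor2.f-mono E)
                 (proj₂ (comp-sat C₃₂ E) (proj₂ (proj₁ (satA EA') s)))

      module _ {t : Der3 R₁ R₂ R₃ (Comp.I₂₁ C₁)} (EB : EmbB C₃₂ C₁ t) (i : EmbB.f EB ≡ id)
               (EA : EmbA C₂₁ C₃ t) where
        private
          Over : Hom (Comp.I₂₁ C₁) X → Set (o ⊔ ℓ)
          Over {X} p = Σ[ t' ∈ Der3 R₁ R₂ R₃ X ] Σ[ EB' ∈ EmbB C₃₂ C₁ t' ] EmbB.f EB' ≡ p

          transfer-A : {t' : Der3 R₁ R₂ R₃ Y} (EB' : EmbB C₃₂ C₁ t') → EmbA C₂₁ C₃ t'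
          transfer-A EB' = compA C₂₁ C₃
            (morB C₃₂ C₁ EB EB' (EmbB.f-mono EB') (_ ∘⟨ i ∙ identityʳ)) EA

        admissible-A : Admissible 𝒞 C₁ → Admissible 𝒞 C₃
        admissible-A adm c≈ = adm (refute (compCond 𝒞 C₁) λ pm → no (derB C₃₂ C₁ pm))
          where
          no : {p : Hom (Comp.I₂₁ C₁) X} → Over p → ¬ Sat 𝒞 p (compCond 𝒞 C₁)
          no (t' , EB' , refl) s =
            let E = transfer-A EB'
            in unsat (compCond 𝒞 C₃) c≈ (EmbA.f-mono E) (proj₂ (satA E) (proj₁ (satB EB') s))

        admissible-A₂₁ : Admissible 𝒞 C₁ → Admissible 𝒞 C₂₁
        admissible-A₂₁ adm c≈ = adm (refute (compCond 𝒞 C₁) λ pm → no (derB C₃₂ C₁ pm))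
          where
          no : {p : Hom (Comp.I₂₁ C₁) X} → Over p → ¬ Sat 𝒞 p (compCond 𝒞 C₁)
          no (t' , EB' , refl) s =
            let E = EmbA.E₂₁ (transfer-A EB')
                (s₁ , s₂ , _) = proj₁ (satB EB') s
            in unsat (compCond 𝒞 C₂₁) c≈ (Mor2.f-mono E) (proj₂ (comp-sat C₂₁ E) (s₁ , s₂))

-- The bijection and the isomorphism of the nested composites.

module Associativity {o ℓ : Level} (𝒞 : Category o ℓ) (𝒜 : SqPOAdhesive 𝒞) where
  open Category 𝒞
  open SqPOAdhesive 𝒜
  open SqPORewriting 𝒞 𝒜
  open Derivations 𝒞 𝒜
  open MatchIsomorphisms 𝒞 𝒜
  open ApplicationConditions 𝒞 𝒜

  private variable
    A B D T X : Obj

  module _ {r : Rule 𝒞} (S : Step r X) (bi : Iso 𝒞 (Step.b S)) where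
    private
      open Step S
      b⁻ = proj₁ bi
      bb⁻ : b ∘ b⁻ ≡ id
      bb⁻ = proj₂ (proj₂ bi)
      -- An invertible match covers `X`, so `meet`, tested with the identity of the context, puts
      -- the whole context into `inL`.
      kk : Σ[ w ∈ Hom Ctx (R.Ker r) ] R.inL r ∘ w ≡ b⁻ ∘ d
      kk = meet (b⁻ ∘ d) id (cancel bb⁻ d ∙ sym identityʳ)

    k-iso : Iso 𝒞 k
    k-iso = k⁻ , k-mono _ _ (cancel kk⁻ k ∙ sym identityʳ) , kk⁻
      where
      k⁻ = proj₁ kk
      kk⁻ : k ∘ k⁻ ≡ id
      kk⁻ = d-mono _ _ (push (sym sq) k⁻ ∙ b ∘⟨ proj₂ kk ∙ cancel bb⁻ d ∙ sym identityʳ)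

    a-iso : Iso 𝒞 a
    a-iso = a⁻ , a⁻a
          , PO.unique po _ _ (assoc ∙ a ∘⟨ a⁻a ∙ identityʳ ∙ sym identityˡ)
              (assoc ∙ a ∘⟨ a⁻e ∙ pull (PO.commute po) _ ∙ assoc ∙ e ∘⟨ proj₂ (proj₂ k-iso)
               ∙ identityʳ ∙ sym identityˡ)
      where
      uu = PO.universal po id (R.outL r ∘ proj₁ k-iso)
             (identityˡ ∙ sym (assoc ∙ R.outL r ∘⟨ proj₁ (proj₂ k-iso) ∙ identityʳ))
      a⁻ = proj₁ uu
      a⁻a : a⁻ ∘ a ≡ id
      a⁻a = proj₁ (proj₂ uu)
      a⁻e : a⁻ ∘ e ≡ R.outL r ∘ proj₁ k-iso
      a⁻e = proj₂ (proj₂ uu)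

  ∘-iso : {f : Hom B D} {g : Hom A B} → Iso 𝒞 f → Iso 𝒞 g → Iso 𝒞 (f ∘ g)
  ∘-iso {f = f} {g} (f⁻ , f⁻f , ff⁻) (g⁻ , g⁻g , gg⁻) =
    g⁻ ∘ f⁻ , (assoc ∙ g⁻ ∘⟨ cancel f⁻f g ∙ g⁻g) , (assoc ∙ f ∘⟨ cancel gg⁻ f⁻ ∙ ff⁻)

  inv : {f : Hom A B} → Iso 𝒞 f → Hom B A
  inv = proj₁

  inv-iso : {f : Hom A B} (i : Iso 𝒞 f) → Iso 𝒞 (inv i)
  inv-iso {f = f} (_ , gf , fg) = f , fg , gf

  -- Rules that make the same step from X at invertible matches are isomorphic.
  module RuleIso {r r' : Rule 𝒞} (S : Step r X) (S' : Step r' X)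
                 (ρ : Hom (Step.H S) (Step.H S')) (ρ-iso : Iso 𝒞 ρ)
                 (ψ : Hom (Step.Ctx S) (Step.Ctx S')) (ψ⁻ : Hom (Step.Ctx S') (Step.Ctx S))
                 (dψ : Step.d S' ∘ ψ ≡ Step.d S) (dψ⁻ : Step.d S ∘ ψ⁻ ≡ Step.d S')
                 (eψ : Step.e S' ∘ ψ ≡ ρ ∘ Step.e S)
                 (bi : Iso 𝒞 (Step.b S)) (bi' : Iso 𝒞 (Step.b S')) where
    private
      module S  = Step S
      module S' = Step S'
      k' = k-iso S' bi'
      a' = a-iso S' bi'
      ψ-iso : Iso 𝒞 ψ
      ψ-iso = ψ⁻ , S.d-mono _ _ (pull dψ⁻ ψ ∙ dψ ∙ sym identityʳ)
                 , S'.d-mono _ _ (pull dψ ψ⁻ ∙ dψ⁻ ∙ sym identityʳ)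

    φO : Hom (R.Out r) (R.Out r')
    φO = inv a' ∘ ρ ∘ S.a
    φK : Hom (R.Ker r) (R.Ker r')
    φK = inv k' ∘ ψ ∘ S.k
    φI : Hom (R.In r) (R.In r')
    φI = inv bi' ∘ S.b

    φO-iso : Iso 𝒞 φO
    φO-iso = ∘-iso (inv-iso a') (∘-iso ρ-iso (a-iso S bi))
    φK-iso : Iso 𝒞 φK
    φK-iso = ∘-iso (inv-iso k') (∘-iso ψ-iso (k-iso S bi))
    φI-iso : Iso 𝒞 φI
    φI-iso = ∘-iso (inv-iso bi') bi

    private
      kφ : S'.k ∘ φK ≡ ψ ∘ S.k
      kφ = cancel (proj₂ (proj₂ k')) _

    out-comm : R.outL r' ∘ φK ≡ φO ∘ R.outL r
    out-comm = S'.a-mono _ _ (push (PO.commute S'.po) φK ∙ S'.e ∘⟨ kφ ∙ pull eψ S.k ∙ assoc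
      ∙ ρ ∘⟨ sym (PO.commute S.po) ∙ sym assoc
      ∙ sym (sym assoc ∙ cancel (proj₂ (proj₂ a')) (ρ ∘ S.a) ⟩∘ R.outL r))

    in-comm : R.inL r' ∘ φK ≡ φI ∘ R.inL r
    in-comm = S'.b-mono _ _ (push S'.sq φK ∙ S'.d ∘⟨ kφ ∙ pull dψ S.k ∙ sym S.sq
      ∙ sym (sym assoc ∙ cancel (proj₂ (proj₂ bi')) S.b ⟩∘ R.inL r))

  module _ {R₁ R₂ R₃ : RuleC 𝒞} where
    module _ {μ₂₁ : Span 𝒞 (InC 𝒞 R₂) (OutC 𝒞 R₁)} (C₂₁ : Comp 𝒞 R₂ R₁ μ₂₁)
             {μ₃ : Span 𝒞 (InC 𝒞 R₃) (OutC 𝒞 (compRuleC 𝒞 C₂₁))}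
             (C₃ : Comp 𝒞 R₃ (compRuleC 𝒞 C₂₁) μ₃)
             {μ₃₂ : Span 𝒞 (InC 𝒞 R₃) (OutC 𝒞 R₂)} (C₃₂ : Comp 𝒞 R₃ R₂ μ₃₂)
             {μ₁ : Span 𝒞 (InC 𝒞 (compRuleC 𝒞 C₃₂)) (OutC 𝒞 R₁)}
             (C₁ : Comp 𝒞 (compRuleC 𝒞 C₃₂) R₁ μ₁)
             {t : Der3 R₁ R₂ R₃ X} (EA : EmbA C₂₁ C₃ t) (EB : EmbB C₃₂ C₁ t) where
      open Der3 t
      open EmbA EA using (E₂₁; E₃)
      open EmbB EB using (E₃₂; E₁)
      private
        SA = composed C₃ E₃
        SB = composed C₁ E₁
        module SA = Step SA
        module SB = Step SB

      -- In either bracketing the context consists of what survives all three steps, so an element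
      -- is split into its three traces and reassembled.
      reassoc : (x : Hom T SA.Ctx) →
                Σ[ y ∈ Hom T SB.Ctx ] (SB.d ∘ y ≡ SA.d ∘ x × SB.e ∘ y ≡ SA.e ∘ x)
      reassoc x =
        let (x₁₂ , x₃ , p , dx , ex)    = composed-split C₃ E₃ x
            (x₁ , x₂ , q , dx₁₂ , ex₁₂) = composed-split C₂₁ E₂₁ x₁₂
            (y₂₃ , dy₂₃ , ey₂₃)         = composed-lift C₃₂ E₃₂ x₂ x₃ (sym ex₁₂ ∙ p)
            (y , dy , ey)               = composed-lift C₁ E₁ x₁ y₂₃ (q ∙ sym dy₂₃)
        in y , (dy ∙ sym dx₁₂ ∙ sym dx) , (ey ∙ ey₂₃ ∙ sym ex)

      reassoc⁻ : (y : Hom T SB.Ctx) → Σ[ x ∈ Hom T SA.Ctx ] SA.d ∘ x ≡ SB.d ∘ y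
      reassoc⁻ y =
        let (y₁ , y₂₃ , p , dy , ey)    = composed-split C₁ E₁ y
            (y₂ , y₃ , q , dy₂₃ , ey₂₃) = composed-split C₃₂ E₃₂ y₂₃
            (x₁₂ , dx₁₂ , ex₁₂)         = composed-lift C₂₁ E₂₁ y₁ y₂ (p ∙ dy₂₃)
            (x , dx , ex)               = composed-lift C₃ E₃ x₁₂ y₃ (ex₁₂ ∙ q)
        in x , (dx ∙ dx₁₂ ∙ sym dy)

      module Associate (bi : Iso 𝒞 (EmbA.f EA)) (bi' : Iso 𝒞 (EmbB.f EB)) where
        private
          there = reassoc id
          back' = reassoc⁻ id
        open RuleIso SA SB id id-iso (proj₁ there) (proj₁ back')
          (proj₁ (proj₂ there) ∙ identityʳ) (proj₂ back' ∙ identityʳ)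
          (proj₂ (proj₂ there) ∙ identityʳ ∙ sym identityˡ) bi bi' public

    analyseA : (t : Der3 R₁ R₂ R₃ X) →
      Σ[ μ₂₁ ∈ Span 𝒞 (InC 𝒞 R₂) (OutC 𝒞 R₁) ] Σ[ C₂₁ ∈ Comp 𝒞 R₂ R₁ μ₂₁ ]
      Σ[ μ₃ ∈ Span 𝒞 (InC 𝒞 R₃) (OutC 𝒞 (compRuleC 𝒞 C₂₁)) ]
      Σ[ C₃ ∈ Comp 𝒞 R₃ (compRuleC 𝒞 C₂₁) μ₃ ] EmbA C₂₁ C₃ t
    analyseA (mkDer3 S₁ S₂ S₃) =
      let (μ₂₁ , C₂₁ , E₂₁) = compose R₁ R₂ S₁ S₂
          (μ₃ , C₃ , E₃)    = compose (compRuleC 𝒞 C₂₁) R₃ (composed C₂₁ E₂₁) S₃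
      in μ₂₁ , C₂₁ , μ₃ , C₃ , mkEmbA E₂₁ E₃

    analyseB : (t : Der3 R₁ R₂ R₃ X) →
      Σ[ μ₃₂ ∈ Span 𝒞 (InC 𝒞 R₃) (OutC 𝒞 R₂) ] Σ[ C₃₂ ∈ Comp 𝒞 R₃ R₂ μ₃₂ ]
      Σ[ μ₁ ∈ Span 𝒞 (InC 𝒞 (compRuleC 𝒞 C₃₂)) (OutC 𝒞 R₁) ]
      Σ[ C₁ ∈ Comp 𝒞 (compRuleC 𝒞 C₃₂) R₁ μ₁ ] EmbB C₃₂ C₁ t
    analyseB (mkDer3 S₁ S₂ S₃) =
      let (μ₃₂ , C₃₂ , E₃₂) = compose R₂ R₃ S₂ S₃
          (μ₁ , C₁ , E₁)    = compose R₁ (compRuleC 𝒞 C₃₂) S₁ (composed C₃₂ E₃₂)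
      in μ₃₂ , C₃₂ , μ₁ , C₁ , mkEmbB E₃₂ E₁

    EmbedA : MA 𝒞 R₁ R₂ R₃ → Der3 R₁ R₂ R₃ X → Set (o ⊔ ℓ)
    EmbedA a = EmbA (MA.C₂₁ a) (MA.C₃ a)

    EmbedB : MB 𝒞 R₁ R₂ R₃ → Der3 R₁ R₂ R₃ X → Set (o ⊔ ℓ)
    EmbedB b = EmbB (MB.C₃₂ b) (MB.C₁ b)

    InA : MA 𝒞 R₁ R₂ R₃ → Obj
    InA a = Comp.I₂₁ (MA.C₃ a)

    InB : MB 𝒞 R₁ R₂ R₃ → Obj
    InB b = Comp.I₂₁ (MB.C₁ b)

    module _ (a : MA 𝒞 R₁ R₂ R₃) {t : Der3 R₁ R₂ R₃ (InA a)} (EA : EmbedA a t)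
             (i : EmbA.f EA ≡ id) where
      rebracketB : Σ[ b ∈ MB 𝒞 R₁ R₂ R₃ ] EmbedB b t
      rebracketB = let (_ , C₃₂ , _ , C₁ , EB) = analyseB t in
        record { C₃₂ = C₃₂ ; adm₃₂ = admissible-B₃₂ (MA.C₂₁ a) (MA.C₃ a) C₃₂ C₁ EA i EB (MA.adm₃ a)
               ; C₁ = C₁ ; adm₁ = admissible-B (MA.C₂₁ a) (MA.C₃ a) C₃₂ C₁ EA i EB (MA.adm₃ a) }
        , EB

    module _ (b : MB 𝒞 R₁ R₂ R₃) {t : Der3 R₁ R₂ R₃ (InB b)} (EB : EmbedB b t)
             (i : EmbB.f EB ≡ id) where
      rebracketA : Σ[ a ∈ MA 𝒞 R₁ R₂ R₃ ] EmbedA a t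
      rebracketA = let (_ , C₂₁ , _ , C₃ , EA) = analyseA t in
        record { C₂₁ = C₂₁ ; adm₂₁ = admissible-A₂₁ C₂₁ C₃ (MB.C₃₂ b) (MB.C₁ b) EB i EA (MB.adm₁ b)
               ; C₃ = C₃ ; adm₃ = admissible-A C₂₁ C₃ (MB.C₃₂ b) (MB.C₁ b) EB i EA (MB.adm₁ b) }
        , EA

    -- The derivation obtained by applying the composite rule at the identity of its input.
    CanonA : MA 𝒞 R₁ R₂ R₃ → Set (o ⊔ ℓ)
    CanonA a = Σ[ t ∈ Der3 R₁ R₂ R₃ (InA a) ] Σ[ EA ∈ EmbedA a t ] EmbA.f EA ≡ id

    CanonB : MB 𝒞 R₁ R₂ R₃ → Set (o ⊔ ℓ)
    CanonB b = Σ[ t ∈ Der3 R₁ R₂ R₃ (InB b) ] Σ[ EB ∈ EmbedB b t ] EmbB.f EB ≡ id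

    module _ {a a' : MA 𝒞 R₁ R₂ R₃} {b b' : MB 𝒞 R₁ R₂ R₃}
             (ca : CanonA a) (ca' : CanonA a')
             (Eb : EmbedB b (proj₁ ca)) (Eb' : EmbedB b' (proj₁ ca')) where
      -- `σ` makes `a` occur in the derivation of `a'`, which gives a morphism from the derivation
      -- of `a`. Along it `b` comes to lie next to `b'`, and `simB` compares them there.
      simA⇒simB : SimA 𝒞 a a' → SimB 𝒞 b b'
      simA⇒simB σ =
        let (t , EA , i)  = ca
            (t' , EA' , _) = ca'
            EA″ = simA-emb {a = a} {a'} σ EA'
            G   = morA (MA.C₂₁ a) (MA.C₃ a) EA EA″ (EmbA.f-mono EA″) (_ ∘⟨ i ∙ identityʳ)
        in simB {b = b} {b'} (compB (MB.C₃₂ b) (MB.C₁ b) G Eb) Eb'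

    module _ {b b' : MB 𝒞 R₁ R₂ R₃} {a a' : MA 𝒞 R₁ R₂ R₃}
             (cb : CanonB b) (cb' : CanonB b')
             (Ea : EmbedA a (proj₁ cb)) (Ea' : EmbedA a' (proj₁ cb')) where
      simB⇒simA : SimB 𝒞 b b' → SimA 𝒞 a a'
      simB⇒simA σ =
        let (t , EB , i)  = cb
            (t' , EB' , _) = cb'
            EB″ = simB-emb {b = b} {b'} σ EB'
            G   = morB (MB.C₃₂ b) (MB.C₁ b) EB EB″ (EmbB.f-mono EB″) (_ ∘⟨ i ∙ identityʳ)
        in simA {a = a} {a'} (compA (MA.C₂₁ a) (MA.C₃ a) G Ea) Ea'

    module _ {a : MA 𝒞 R₁ R₂ R₃} {b : MB 𝒞 R₁ R₂ R₃} (ca : CanonA a) (cb : CanonB b)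
             (Eb : EmbedB b (proj₁ ca)) where
      private
        t = proj₁ ca
        EA : EmbedA a t
        EA = proj₁ (proj₂ ca)
        EB : EmbedB b (proj₁ cb)
        EB = proj₁ (proj₂ cb)
        i : EmbA.f EA ≡ id
        i = proj₂ (proj₂ ca)
        j : EmbB.f EB ≡ id
        j = proj₂ (proj₂ cb)
        q : Hom (InB b) (InA a)
        q = EmbB.f Eb
        qm : Mon q
        qm = EmbB.f-mono Eb
        G : Mor3 (proj₁ cb) t
        G = morB (MB.C₃₂ b) (MB.C₁ b) EB Eb qm (q ∘⟨ j ∙ identityʳ)

      there-and-back-A : {a' : MA 𝒞 R₁ R₂ R₃} → EmbedA a' (proj₁ cb) → SimA 𝒞 a' a
      there-and-back-A {a'} Ea' = simA {a = a'} {a} (compA (MA.C₂₁ a') (MA.C₃ a') G Ea') EA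

      private
        -- By leastness the composite of `a`, occurring in `t` at the identity, already occurs in
        -- the restriction along `q`. Its match `s` is a section of the monic `q`, which is
        -- therefore invertible.
        lift-q : Σ[ E ∈ EmbedA a (proj₁ cb) ] Mor3.f G ∘ EmbA.f E ≡ EmbA.f EA
        lift-q = factorA (MA.C₂₁ a) (MA.C₃ a) EA G
        s : Hom (InA a) (InB b)
        s = EmbA.f (proj₁ lift-q)
        qs : q ∘ s ≡ id
        qs = proj₂ lift-q ∙ i
        q-iso : Iso 𝒞 q
        q-iso = s , qm _ _ (cancel qs q ∙ sym identityʳ) , qs
        EA-iso : Iso 𝒞 (EmbA.f EA)
        EA-iso = subst (Iso 𝒞) (sym i) id-iso
        module As = Associate (MA.C₂₁ a) (MA.C₃ a) (MB.C₃₂ b) (MB.C₁ b) EA Eb EA-iso q-iso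
        p-eq : {p : Hom (InB b) X} → (p ∘ As.φI) ∘ q ≡ p
        p-eq {p = p} = assoc ∙ p ∘⟨ (assoc ∙ s ∘⟨ (i ⟩∘ q ∙ identityˡ) ∙ proj₁ (proj₂ q-iso))
                       ∙ identityʳ

      results-iso : RuleCIso 𝒞 (resultA 𝒞 a) (resultB 𝒞 b)
      results-iso = record
        { φO = As.φO ; φK = As.φK ; φI = As.φI
        ; φO-iso = As.φO-iso ; φK-iso = As.φK-iso ; φI-iso = As.φI-iso
        ; out-comm = As.out-comm ; in-comm = As.in-comm
        ; cond-equiv = λ p pm → subst
            (λ x → Sat 𝒞 (p ∘ As.φI) (compCond 𝒞 (MA.C₃ a)) ⟷ Sat 𝒞 x (compCond 𝒞 (MB.C₁ b))) p-eq
            (sat-A⇒B (MA.C₂₁ a) (MA.C₃ a) (MB.C₃₂ b) (MB.C₁ b) EA i Eb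
              (∘-mono pm (iso-mono As.φI-iso))) }

    module _ {b : MB 𝒞 R₁ R₂ R₃} {a : MA 𝒞 R₁ R₂ R₃} (cb : CanonB b) (ca : CanonA a)
             (Ea : EmbedA a (proj₁ cb)) where
      there-and-back-B : {b' : MB 𝒞 R₁ R₂ R₃} → EmbedB b' (proj₁ ca) → SimB 𝒞 b' b
      there-and-back-B {b'} Eb' =
        let (t , EB , i)  = cb
            (t' , EA , j) = ca
            G = morA (MA.C₂₁ a) (MA.C₃ a) EA Ea (EmbA.f-mono Ea) (_ ∘⟨ j ∙ identityʳ)
        in simB {b = b'} {b} (compB (MB.C₃₂ b') (MB.C₁ b') G Eb') EB

    abstract
      canonA : (a : MA 𝒞 R₁ R₂ R₃) → CanonA a
      canonA a = derA (MA.C₂₁ a) (MA.C₃ a) id-mono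

      canonB : (b : MB 𝒞 R₁ R₂ R₃) → CanonB b
      canonB b = derB (MB.C₃₂ b) (MB.C₁ b) id-mono

    associate : (a : MA 𝒞 R₁ R₂ R₃) → Σ[ b ∈ MB 𝒞 R₁ R₂ R₃ ] EmbedB b (proj₁ (canonA a))
    associate a = rebracketB a (proj₁ (proj₂ (canonA a))) (proj₂ (proj₂ (canonA a)))

    associate⁻ : (b : MB 𝒞 R₁ R₂ R₃) → Σ[ a ∈ MA 𝒞 R₁ R₂ R₃ ] EmbedA a (proj₁ (canonB b))
    associate⁻ b = rebracketA b (proj₁ (proj₂ (canonB b))) (proj₂ (proj₂ (canonB b)))

theorem5p7 : ∀ {o ℓ} (𝒞 : Category o ℓ) → SqPOAdhesive 𝒞 → (R₁ R₂ R₃ : RuleC 𝒞) →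
    Σ (MA 𝒞 R₁ R₂ R₃ → MB 𝒞 R₁ R₂ R₃) λ F →
    Σ (MB 𝒞 R₁ R₂ R₃ → MA 𝒞 R₁ R₂ R₃) λ G →
    ((a a' : MA 𝒞 R₁ R₂ R₃) → SimA 𝒞 a a' → SimB 𝒞 (F a) (F a'))
    × ((b b' : MB 𝒞 R₁ R₂ R₃) → SimB 𝒞 b b' → SimA 𝒞 (G b) (G b'))
    × ((a : MA 𝒞 R₁ R₂ R₃) → SimA 𝒞 (G (F a)) a)
    × ((b : MB 𝒞 R₁ R₂ R₃) → SimB 𝒞 (F (G b)) b)
    × ((a : MA 𝒞 R₁ R₂ R₃) → RuleCIso 𝒞 (resultA 𝒞 a) (resultB 𝒞 (F a)))
theorem5p7 𝒞 𝒜 R₁ R₂ R₃ = F , G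
  , (λ a a' → simA⇒simB {a = a} {a'} {F a} {F a'} (canonA a) (canonA a')
                (proj₂ (associate a)) (proj₂ (associate a')))
  , (λ b b' → simB⇒simA {b = b} {b'} {G b} {G b'} (canonB b) (canonB b')
                (proj₂ (associate⁻ b)) (proj₂ (associate⁻ b')))
  , (λ a → there-and-back-A {a = a} {F a} (canonA a) (canonB (F a)) (proj₂ (associate a))
             {G (F a)} (proj₂ (associate⁻ (F a))))
  , (λ b → there-and-back-B {b = b} {G b} (canonB b) (canonA (G b)) (proj₂ (associate⁻ b))
             {F (G b)} (proj₂ (associate (G b))))
  , (λ a → results-iso {a = a} {F a} (canonA a) (canonB (F a)) (proj₂ (associate a)))
  where
  open Associativity 𝒞 𝒜
  F : MA 𝒞 R₁ R₂ R₃ → MB 𝒞 R₁ R₂ R₃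
  F a = proj₁ (associate a)
  G : MB 𝒞 R₁ R₂ R₃ → MA 𝒞 R₁ R₂ R₃
  G b = proj₁ (associate⁻ b)
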